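{- Fix an integer $k\ge 2$. The approximation ratio of the $k$-Opt algorithm for \textsc{Metric TSP} is $\Omega\!\left(\frac{n}{\operatorname{ex}^{ -1}(n,2k)}\right)$, where $n$ is the number of vertices.
   Context: A \textsc{Metric TSP} instance is a complete graph $K_n$ with nonnegative costs satisfying the triangle inequality; a tour is a Hamiltonian cycle. A $k$-move replaces at most $k$ edges of a tour by other edges to get a new tour; a tour is $k$-optimal if no $k$-move yields a shorter tour. The $k$-Opt algorithm's approximation ratio on $n$-vertex instances is the supremum over all $n$-vertex instances and all $k$-optimal tours $T$ of $c(T)/c(T^*)$, $T^*$ an optimal tour. $\operatorname{ex}^{ -1}(m,2k)$ denotes the minimum number of vertices of a graph with $m$ edges and girth at least $2k$. -}

module Defs where

open import Data.Nat using (ℕ; zero; suc; _+_; _*_; _≤_; _<_)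
open import Data.Nat.DivMod using (_%_; m%n<n)
open import Data.Fin using (Fin; toℕ; fromℕ<)
open import Data.Product using (Σ; _×_; _,_; ∃; proj₁; proj₂)
open import Data.Sum using (_⊎_)
open import Data.List using (List; length)
open import Data.List.Membership.Propositional using (_∈_; _∉_)
open import Data.List.Relation.Unary.All using (All)
open import Data.List.Relation.Unary.Unique.Propositional using (Unique)
open import Relation.Binary.PropositionalEquality using (_≡_)
open import Relation.Nullary using (¬_)
open import Function.Definitions using (Injective)

sucMod : ∀ {n} → Fin n → Fin n
sucMod {zero} ()
sucMod {suc m} i = fromℕ< (m%n<n (suc (toℕ i)) (suc m))

record Graph (v : ℕ) : Set where
  field
    edges   : List (Fin v × Fin v)
    ordered : All (λ e → toℕ (proj₁ e) < toℕ (proj₂ e)) edges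
    unique  : Unique edges

open Graph public

Adj : ∀ {v} → Graph v → Fin v → Fin v → Set
Adj G x y = ((x , y) ∈ edges G) ⊎ ((y , x) ∈ edges G)

HasCycleOfLength : ∀ {v} → Graph v → ℕ → Set
HasCycleOfLength {v} G ℓ =
  3 ≤ ℓ × Σ (Fin ℓ → Fin v) λ f →
    Injective _≡_ _≡_ f × (∀ i → Adj G (f i) (f (sucMod i)))

-- girth ≥ g : no cycle of length < g  (acyclic graphs have infinite girth)
GirthAtLeast : ∀ {v} → Graph v → ℕ → Set
GirthAtLeast G g = ∀ ℓ → ℓ < g → ¬ HasCycleOfLength G ℓ

IsExInv : ℕ → ℕ → ℕ → Set
IsExInv m g v =
  Σ (Graph v) (λ G → length (edges G) ≡ m × GirthAtLeast G g)
  × (∀ w (G : Graph w) → length (edges G) ≡ m → GirthAtLeast G g → v ≤ w)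

record Metric (n : ℕ) : Set where
  field
    c     : Fin n → Fin n → ℕ
    diag  : ∀ x → c x x ≡ 0
    sym   : ∀ x y → c x y ≡ c y x
    tri   : ∀ x y z → c x z ≤ c x y + c y z

open Metric public

-- a tour: a cyclic ordering of all vertices, T(0), T(1), ..., T(n-1), T(0)
Tour : ℕ → Set
Tour n = Σ (Fin n → Fin n) (Injective _≡_ _≡_)

sumFin : ∀ n → (Fin n → ℕ) → ℕ
sumFin zero f = 0
sumFin (suc n) f = f Fin.zero + sumFin n (λ i → f (Fin.suc i))

cost : ∀ {n} → Metric n → Tour n → ℕ
cost {n} M (T , _) = sumFin n (λ i → c M (T i) (T (sucMod i)))

TourEdge : ∀ {n} → Tour n → Fin n → Fin n → Set
TourEdge (T , _) x y =
  ∃ λ j → (T j ≡ x × T (sucMod j) ≡ y) ⊎ (T j ≡ y × T (sucMod j) ≡ x)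

KMove : ℕ → ∀ {n} → Tour n → Tour n → Set
KMove k {n} T T' =
  Σ (List (Fin n)) λ S → length S ≤ k ×
    (∀ i → i ∉ S → TourEdge T' (proj₁ T i) (proj₁ T (sucMod i)))

KOptimal : ℕ → ∀ {n} → Metric n → Tour n → Set
KOptimal k M T = ∀ T' → KMove k T T' → cost M T ≤ cost M T'

OptimalTour : ∀ {n} → Metric n → Tour n → Set
OptimalTour M T = ∀ T' → cost M T ≤ cost M T'

{-# OPTIONS --safe #-}
module Submission where

-- Take a graph with n edges, v vertices and girth at least 2k.  If n ≤ 2v, any optimal tour will do.  Otherwise decompose
-- it greedily into edge-disjoint closed trails missing at most v edges, and merge trails sharing a vertex; one of the
-- merged trails, W, has as large an edge-to-vertex ratio as the average, at least n / 2v.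
--
-- Let the tour T follow W, with all remaining cities placed at the base of W, and let the cost be the distance in the
-- graph capped at k.  (Distinct cities at distance 0 are allowed, and the cap makes any tour that visits the cities
-- vertex by vertex cost O(k) per vertex of W.)  If a k-move shortens T, the removed edges together with
-- shortest paths for the added edges are fewer than 2k graph edges, of even degree at each vertex.  By the girth
-- condition they cancel modulo 2, so each removed edge lies on an added path and the move does not gain after all.

open import Defs hiding (sym)
open import Data.Bool using (Bool; true; false; not; _xor_)
open import Data.Bool.Properties using (xor-same; xor-assoc; xor-comm)
open import Data.Nat using (ℕ; zero; suc; _+_; _*_; _≤_; _<_; z≤n; s≤s; s≤s⁻¹; ∣_-_∣)
open import Data.Nat.DivMod using (_%_; m<n⇒m%n≡m; n%n≡0)
open import Data.Nat.Properties hiding (_≟_; suc-injective)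
import Data.Nat.Properties as ℕ
open import Data.Nat.ListAction using (sum)
open import Data.Nat.ListAction.Properties using (sum-++; sum-↭)
open import Data.Nat.Tactic.RingSolver using (solve-∀)
open import Data.Fin using (Fin; zero; suc; toℕ; inject₁; fromℕ)
open import Data.Fin.Induction using (<-weakInduction)
open import Data.Fin.Properties using (_≟_; any?; all?; suc-injective; toℕ-injective; toℕ-fromℕ<; toℕ-fromℕ; toℕ-inject₁; toℕ<n)
open import Data.Fin.Relation.Unary.Top using (view; ‵fromℕ; ‵inject₁)
open import Data.Vec.Functional as Vector using ()
open import Data.Product using (Σ; _×_; _,_; ∃; proj₁; proj₂)
open import Data.Product.Properties using (≡-dec)
open import Data.Sum using (_⊎_; inj₁; inj₂)
open import Data.Empty using (⊥; ⊥-elim)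
open import Data.List using (List; []; _∷_; _++_; length; map; concatMap; filter; allFin; lookup; tabulate)
open import Data.List.Properties using (length-++; length-map; length-tabulate; ++-identityʳ; ++-assoc; map-++; map-∘; map-tabulate; map-cong-local; concatMap-map; concatMap-++)
open import Data.List.Membership.Propositional using (_∈_; _∉_; find; lose)
open import Data.List.Membership.Propositional.Properties using (∈-∃++; ∈-allFin; ∈-map⁻; ∈-++⁺ˡ; ∈-++⁺ʳ; ∈-concatMap⁺; ∈-concatMap⁻; ∈-filter⁺; ∈-filter⁻; ∈-length; ∈-lookup)
open import Data.List.Relation.Binary.Permutation.Propositional
  using (_↭_; prep; swap; ↭-sym; ↭-trans; ↭-refl; ↭-reflexive; ↭⇒↭ₛ)
import Data.List.Relation.Binary.Permutation.Propositional as Perm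
open import Data.List.Relation.Binary.Permutation.Propositional.Properties
  using (shift; shifts; ∈-resp-↭; All-resp-↭; ↭-length; map⁺; ++-comm; ++⁺ˡ; ++⁺ʳ)
import Data.List.Relation.Binary.Permutation.Setoid.Properties as Setoid↭
open import Data.List.Relation.Unary.All as All using (All; []; _∷_)
open import Data.List.Relation.Unary.All.Properties using (¬All⇒Any¬; ¬Any⇒All¬)
import Data.List.Relation.Unary.All.Properties as AllP
open import Data.List.Relation.Unary.AllPairs using ([]; _∷_)
open import Data.List.Relation.Unary.Any as Any using (Any; here; there)
open import Data.List.Relation.Unary.Unique.Propositional using (Unique)
open import Data.List.Relation.Unary.Unique.Propositional.Properties as Unique using (allFin⁺)
open import Function using (_∘_; id)
open import Function.Definitions using (Injective)
open import Relation.Binary.Definitions using (DecidableEquality)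
open import Relation.Binary.PropositionalEquality
  using (_≡_; _≢_; refl; sym; trans; cong; cong₂; subst; subst₂; setoid; module ≡-Reasoning)
open import Relation.Nullary using (¬_; Dec; yes; no; ¬?; does; _⊎-dec_; _×-dec_; _→-dec_)
open import Relation.Nullary.Decidable using (map′; decidable-stable)

-- Lists and parities

private variable A B : Set

-- Each entry of `xs` is taken out of `ys` in turn. The later entries survive because they differ
-- from the one removed, so containment of a duplicate-free list becomes containment of multisets.
⊆-complement : {xs ys : List A} → Unique xs → All (_∈ ys) xs → ∃ λ zs → ys ↭ xs ++ zs
⊆-complement {ys = ys} [] [] = ys , ↭-refl
⊆-complement {xs = x ∷ xs} (x∉xs ∷ u) (x∈ys ∷ xs⊆ys) with ∈-∃++ x∈ys
... | as , bs , refl = let zs , p = ⊆-complement u (All.zipWith drop (x∉xs , xs⊆ys))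
                       in zs , ↭-trans (shift x as bs) (prep x p)
  where
  drop : ∀ {y} → x ≢ y × y ∈ as ++ x ∷ bs → y ∈ as ++ bs
  drop (x≢y , y∈) with ∈-resp-↭ (shift x as bs) y∈
  ... | here y≡x = ⊥-elim (x≢y (sym y≡x))
  ... | there y∈′ = y∈′

⊆⇒length≤ : {xs ys : List A} → Unique xs → All (_∈ ys) xs → length xs ≤ length ys
⊆⇒length≤ {xs = xs} u s = let zs , p = ⊆-complement u s in
  subst (length xs ≤_) (sym (trans (↭-length p) (length-++ xs))) (m≤m+n _ _)

length≡0⇒[] : {xs : List A} → length xs ≡ 0 → xs ≡ []
length≡0⇒[] {xs = []} _ = refl

-- Pigeonhole: the image is duplicate-free and as long as `allFin n`, so its complement there is
-- empty.
injective⇒map↭ : ∀ {n} (σ : Fin n → Fin n) → Injective _≡_ _≡_ σ → allFin n ↭ map σ (allFin n)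
injective⇒map↭ {n} σ inj with ⊆-complement (Unique.map⁺ inj (allFin⁺ n)) (All.tabulate (λ {x} _ → ∈-allFin x))
... | zs , p = subst (allFin n ↭_) (trans (cong (map σ (allFin n) ++_) zs≡[]) (++-identityʳ _)) p
  where
  zs≡[] : zs ≡ []
  zs≡[] = length≡0⇒[] (+-cancelˡ-≡ (length (allFin n)) _ _ (begin
    length (allFin n) + length zs           ≡⟨ cong (_+ length zs) (sym (length-map σ (allFin n))) ⟩
    length (map σ (allFin n)) + length zs   ≡⟨ sym (length-++ (map σ (allFin n))) ⟩
    length (map σ (allFin n) ++ zs)         ≡⟨ sym (↭-length p) ⟩
    length (allFin n)                       ≡⟨ sym (+-identityʳ _) ⟩
    length (allFin n) + 0                   ∎))
    where open ≡-Reasoning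

Unique-map-local : (f : A → B) {xs : List A} →
  (∀ {x y} → x ∈ xs → y ∈ xs → f x ≡ f y → x ≡ y) → Unique xs → Unique (map f xs)
Unique-map-local f inj [] = []
Unique-map-local f {x ∷ xs} inj (x∉ ∷ u) =
  All.tabulate fresh ∷ Unique-map-local f (λ p q → inj (there p) (there q)) u
  where
  fresh : ∀ {z} → z ∈ map f xs → f x ≢ z
  fresh z∈ fx≡z with ∈-map⁻ f z∈
  ... | y , y∈ , refl = All.lookup x∉ y∈ (inj (here refl) (there y∈) fx≡z)

∈⇒↭∷ : {x : A} {xs : List A} → x ∈ xs → ∃ λ ys → xs ↭ x ∷ ys
∈⇒↭∷ {x = x} x∈ with ∈-∃++ x∈
... | as , bs , refl = as ++ bs , shift x as bs

Unique-++⁻ʳ : (xs : List A) {ys : List A} → Unique (xs ++ ys) → Unique ys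
Unique-++⁻ʳ [] u = u
Unique-++⁻ʳ (x ∷ xs) (_ ∷ u) = Unique-++⁻ʳ xs u

Unique-++⁻ˡ : (xs : List A) {ys : List A} → Unique (xs ++ ys) → Unique xs
Unique-++⁻ˡ [] u = []
Unique-++⁻ˡ (x ∷ xs) (x∉ ∷ u) = All.tabulate (λ y∈ → All.lookup x∉ (∈-++⁺ˡ y∈)) ∷ Unique-++⁻ˡ xs u

Unique-resp-↭ : {xs ys : List A} → xs ↭ ys → Unique xs → Unique ys
Unique-resp-↭ = Setoid↭.Unique-resp-↭ (setoid _) ∘ ↭⇒↭ₛ

concatMap-↭ : (f : A → List B) {xs ys : List A} → xs ↭ ys → concatMap f xs ↭ concatMap f ys
concatMap-↭ f Perm.refl = ↭-refl
concatMap-↭ f (prep x p) = ++⁺ˡ (f x) (concatMap-↭ f p)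
concatMap-↭ f (swap x y p) = ↭-trans (shifts (f x) (f y)) (++⁺ˡ (f y) (++⁺ˡ (f x) (concatMap-↭ f p)))
concatMap-↭ f (Perm.trans p q) = ↭-trans (concatMap-↭ f p) (concatMap-↭ f q)

-- A sum in the field with two elements. Lists that agree under `parity φ` for every `φ` are equal
-- modulo 2.
parity : (A → Bool) → List A → Bool
parity φ [] = false
parity φ (x ∷ xs) = φ x xor parity φ xs

parity-++ : (φ : A → Bool) (xs ys : List A) → parity φ (xs ++ ys) ≡ parity φ xs xor parity φ ys
parity-++ φ [] ys = refl
parity-++ φ (x ∷ xs) ys = trans (cong (φ x xor_) (parity-++ φ xs ys)) (sym (xor-assoc (φ x) _ _))

xor-swap : ∀ a b c → a xor (b xor c) ≡ b xor (a xor c)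
xor-swap a b c = trans (sym (xor-assoc a b c)) (trans (cong (_xor c) (xor-comm a b)) (xor-assoc b a c))

xor-interchange : ∀ a b c d → (a xor b) xor (c xor d) ≡ (a xor c) xor (b xor d)
xor-interchange a b c d = trans (xor-assoc a b _) (trans (cong (a xor_) (xor-swap b c d)) (sym (xor-assoc a c _)))

xor≡false⇒≡ : ∀ a b → a xor b ≡ false → a ≡ b
xor≡false⇒≡ false false _ = refl
xor≡false⇒≡ true true _ = refl

xor-cancel : ∀ a b → a xor (a xor b) ≡ b
xor-cancel a b = trans (sym (xor-assoc a a b)) (cong (_xor b) (xor-same a))

parity-↭ : (φ : A → Bool) {xs ys : List A} → xs ↭ ys → parity φ xs ≡ parity φ ys
parity-↭ φ Perm.refl = refl
parity-↭ φ (prep x p) = cong (φ x xor_) (parity-↭ φ p)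
parity-↭ φ (swap {xs} x y p) =
  trans (xor-swap (φ x) (φ y) _) (cong (λ b → φ y xor (φ x xor b)) (parity-↭ φ p))
parity-↭ φ (Perm.trans p q) = trans (parity-↭ φ p) (parity-↭ φ q)

parity-cong : {φ ψ : A → Bool} (xs : List A) → (∀ {x} → x ∈ xs → φ x ≡ ψ x) → parity φ xs ≡ parity ψ xs
parity-cong [] eq = refl
parity-cong (x ∷ xs) eq = cong₂ _xor_ (eq (here refl)) (parity-cong xs (eq ∘ there))

parity-map : (φ : B → Bool) (f : A → B) (xs : List A) → parity φ (map f xs) ≡ parity (φ ∘ f) xs
parity-map φ f [] = refl
parity-map φ f (x ∷ xs) = cong (φ (f x) xor_) (parity-map φ f xs)

parity-concatMap : (φ : B → Bool) (f : A → List B) (xs : List A) →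
  parity φ (concatMap f xs) ≡ parity (parity φ ∘ f) xs
parity-concatMap φ f [] = refl
parity-concatMap φ f (x ∷ xs) =
  trans (parity-++ φ (f x) _) (cong (parity φ (f x) xor_) (parity-concatMap φ f xs))

parity-xor : (φ ψ : A → Bool) (xs : List A) →
  parity (λ x → φ x xor ψ x) xs ≡ parity φ xs xor parity ψ xs
parity-xor φ ψ [] = refl
parity-xor φ ψ (x ∷ xs) =
  trans (cong ((φ x xor ψ x) xor_) (parity-xor φ ψ xs)) (xor-interchange (φ x) (ψ x) _ _)

parity-true : (φ : A → Bool) (xs : List A) → parity φ xs ≡ true → ∃ λ x → x ∈ xs × φ x ≡ true
parity-true φ (x ∷ xs) eq with φ x in φx
... | true = x , here refl , φx
... | false = let y , y∈ , φy = parity-true φ xs eq in y , there y∈ , φy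

-- Two equal entries cancel in every parity, so a second copy of `e` deletes the first instead of
-- being kept.
reduce-mod-2 : DecidableEquality A → (es : List A) → ∃ λ us → Unique us × length us ≤ length es
  × All (_∈ es) us × (∀ φ → parity φ us ≡ parity φ es)
reduce-mod-2 _≟_ [] = [] , [] , z≤n , [] , λ _ → refl
reduce-mod-2 {A} _≟_ (e ∷ es) = step (Any.any? (e ≟_) us)
  where
  r = reduce-mod-2 _≟_ es
  us = proj₁ r
  u = proj₁ (proj₂ r)
  l = proj₁ (proj₂ (proj₂ r))
  s = proj₁ (proj₂ (proj₂ (proj₂ r)))
  q = proj₂ (proj₂ (proj₂ (proj₂ r)))
  step : Dec (e ∈ us) → ∃ λ vs → Unique vs × length vs ≤ suc (length es)
    × All (_∈ e ∷ es) vs × (∀ φ → parity φ vs ≡ parity φ (e ∷ es))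
  step (no e∉) = e ∷ us , All.tabulate (λ y∈ e≡y → e∉ (subst (_∈ us) (sym e≡y) y∈)) ∷ u , s≤s l
    , here refl ∷ All.map there s , λ φ → cong (φ e xor_) (q φ)
  step (yes e∈) with ∈⇒↭∷ e∈
  ... | vs , p with Unique-resp-↭ p u
  ... | _ ∷ uvs = vs , uvs
    , ≤-trans (n≤1+n _) (≤-trans (≤-reflexive (sym (↭-length p))) (≤-trans l (n≤1+n _)))
    , All.map there (All.tail (All-resp-↭ p s))
    , λ φ → trans (sym (xor-cancel (φ e) _)) (cong (φ e xor_) (trans (sym (parity-↭ φ p)) (q φ)))

length-concatMap : (f : A → List B) (xs : List A) → length (concatMap f xs) ≡ sum (map (length ∘ f) xs)
length-concatMap f [] = refl
length-concatMap f (x ∷ xs) = trans (length-++ (f x)) (cong (length (f x) +_) (length-concatMap f xs))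

sum-mono : {f g : A → ℕ} (xs : List A) → (∀ {x} → x ∈ xs → f x ≤ g x) → sum (map f xs) ≤ sum (map g xs)
sum-mono [] le = z≤n
sum-mono (x ∷ xs) le = +-mono-≤ (le (here refl)) (sum-mono xs (le ∘ there))

sum-map-++ : (f : A → ℕ) (xs ys : List A) → sum (map f (xs ++ ys)) ≡ sum (map f xs) + sum (map f ys)
sum-map-++ f xs ys = trans (cong sum (map-++ f xs ys)) (sum-++ (map f xs) (map f ys))

sum-map-↭ : (f : A → ℕ) {xs ys : List A} → xs ↭ ys → sum (map f xs) ≡ sum (map f ys)
sum-map-↭ f p = sum-↭ (map⁺ f p)

sum-map-∈ : (f : A → ℕ) {xs : List A} {x : A} → x ∈ xs → f x ≤ sum (map f xs)
sum-map-∈ f (here refl) = m≤m+n _ _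
sum-map-∈ f {x ∷ _} (there p) = ≤-trans (sum-map-∈ f p) (m≤n+m _ (f x))

sum-map-const-1 : (xs : List A) → sum (map (λ _ → 1) xs) ≡ length xs
sum-map-const-1 [] = refl
sum-map-const-1 (x ∷ xs) = cong suc (sum-map-const-1 xs)

filter-split : {P : A → Set} (P? : ∀ x → Dec (P x)) (xs : List A) →
  xs ↭ filter P? xs ++ filter (¬? ∘ P?) xs
filter-split P? [] = ↭-refl
filter-split P? (x ∷ xs) with P? x
... | yes _ = prep x (filter-split P? xs)
... | no _ = ↭-trans (prep x (filter-split P? xs)) (↭-sym (shift x (filter P? xs) _))

parity-indicator-∉ : (_≟_ : DecidableEquality A) {x : A} {xs : List A} → x ∉ xs → parity (λ y → does (x ≟ y)) xs ≡ false
parity-indicator-∉ _≟_ {xs = []} x∉ = refl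
parity-indicator-∉ _≟_ {x} {y ∷ ys} x∉ with x ≟ y
... | yes x≡y = ⊥-elim (x∉ (here x≡y))
... | no _ = parity-indicator-∉ _≟_ (x∉ ∘ there)

-- Together with the preceding lemma, this detects an edge that occurs in only one of two lists.
parity-indicator-∈ : (_≟_ : DecidableEquality A) {x : A} {xs : List A} → Unique xs → x ∈ xs → parity (λ y → does (x ≟ y)) xs ≡ true
parity-indicator-∈ _≟_ {x} {y ∷ ys} (y∉ ∷ u) x∈ with x ≟ y | x∈
... | yes refl | _ = cong not (parity-indicator-∉ _≟_ λ x∈ys → All.lookup y∉ x∈ys refl)
... | no x≢y | here x≡y = ⊥-elim (x≢y x≡y)
... | no _ | there x∈ys = parity-indicator-∈ _≟_ u x∈ys

-- Walks, cycles and dense closed trails in graphs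

sucMod-inject₁ : ∀ {m} (i : Fin m) → sucMod (inject₁ i) ≡ suc i
sucMod-inject₁ {m} i = toℕ-injective (begin
  toℕ (sucMod (inject₁ i))      ≡⟨ toℕ-fromℕ< _ ⟩
  suc (toℕ (inject₁ i)) % suc m ≡⟨ cong (λ t → suc t % suc m) (toℕ-inject₁ i) ⟩
  suc (toℕ i) % suc m           ≡⟨ m<n⇒m%n≡m (s≤s (toℕ<n i)) ⟩
  suc (toℕ i)                   ∎)
  where open ≡-Reasoning

sucMod-fromℕ : ∀ m → sucMod (fromℕ m) ≡ zero
sucMod-fromℕ m = toℕ-injective (begin
  toℕ (sucMod (fromℕ m))      ≡⟨ toℕ-fromℕ< _ ⟩
  suc (toℕ (fromℕ m)) % suc m ≡⟨ cong (λ t → suc t % suc m) (toℕ-fromℕ m) ⟩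
  suc m % suc m               ≡⟨ n%n≡0 (suc m) ⟩
  0                           ∎)
  where open ≡-Reasoning

Edge : ℕ → Set
Edge v = Fin v × Fin v

private variable
  v n : ℕ
  x y z : Fin v
  e e′ : Edge v
  es fs us : List (Edge v)
  vs : List (Fin v)

_≟ᵉ_ : DecidableEquality (Edge v)
_≟ᵉ_ = ≡-dec _≟_ _≟_

Ordered : Edge v → Set
Ordered e = toℕ (proj₁ e) < toℕ (proj₂ e)

Joins : Edge v → Fin v → Fin v → Set
Joins e x y = e ≡ (x , y) ⊎ e ≡ (y , x)

Touches : Fin v → Edge v → Set
Touches z e = proj₁ e ≡ z ⊎ proj₂ e ≡ z

touches? : (z : Fin v) (e : Edge v) → Dec (Touches z e)
touches? z e = (proj₁ e ≟ z) ⊎-dec (proj₂ e ≟ z)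

flip-joins : Joins e x y → Joins e y x
flip-joins (inj₁ p) = inj₂ p
flip-joins (inj₂ p) = inj₁ p

joins-touchesˡ : Joins e x y → Touches x e
joins-touchesˡ (inj₁ refl) = inj₁ refl
joins-touchesˡ (inj₂ refl) = inj₂ refl

other-end : (z : Fin v) (e : Edge v) → Touches z e → ∃ λ x → Joins e z x
other-end z (a , b) (inj₁ refl) = b , inj₁ refl
other-end z (a , b) (inj₂ refl) = a , inj₂ refl

joins-irrefl : Ordered e → ¬ Joins e x x
joins-irrefl o (inj₁ refl) = <-irrefl refl o
joins-irrefl o (inj₂ refl) = <-irrefl refl o

joins-unique : Ordered e → Ordered e′ → Joins e x y → Joins e′ x y → e ≡ e′
joins-unique o o′ (inj₁ refl) (inj₁ refl) = refl
joins-unique o o′ (inj₁ refl) (inj₂ refl) = ⊥-elim (<-asym o o′)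
joins-unique o o′ (inj₂ refl) (inj₁ refl) = ⊥-elim (<-asym o o′)
joins-unique o o′ (inj₂ refl) (inj₂ refl) = refl

-- The edge list is an index, so that permutations, parities and uniqueness can be stated for it
-- directly. Edges are stored with the smaller end first and may be traversed either way.
data Walk {v} : Fin v → Fin v → List (Edge v) → Set where
  []  : Walk x x []
  _∷_ : Joins e x y → Walk y z es → Walk x z (e ∷ es)

_++ʷ_ : Walk x y es → Walk y z fs → Walk x z (es ++ fs)
[] ++ʷ q = q
(j ∷ p) ++ʷ q = j ∷ (p ++ʷ q)

reverseʷ : Walk x y es → ∃ λ fs → Walk y x fs × fs ↭ es
reverseʷ [] = [] , [] , ↭-refl
reverseʷ (_∷_ {e = e} j p) with reverseʷ p
... | fs , q , π = fs ++ e ∷ [] , q ++ʷ (flip-joins j ∷ [])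
  , ↭-trans (++-comm fs (e ∷ [])) (prep e π)

δ : Fin v → Fin v → Bool
δ z x = does (z ≟ x)

-- The boundary map modulo 2: `parity (∂ z) es` is the parity of the degree of `z` in `es`.
∂ : Fin v → Edge v → Bool
∂ z (x , y) = δ z x xor δ z y

∂-joins : ∀ z → Joins {v} e x y → ∂ z e ≡ δ z x xor δ z y
∂-joins z (inj₁ refl) = refl
∂-joins z (inj₂ refl) = xor-comm (δ z _) _

-- The sum telescopes: every passage through an inner vertex counts it twice.
parity-walk : (z : Fin v) → Walk x y es → parity (∂ z) es ≡ δ z x xor δ z y
parity-walk {x = x} z [] = sym (xor-same (δ z x))
parity-walk {x = x} {y = y} z (_∷_ {e = e} {y = m} {es = es} j p) = begin
  ∂ z e xor parity (∂ z) es                 ≡⟨ cong₂ _xor_ (∂-joins z j) (parity-walk z p) ⟩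
  (δ z x xor δ z m) xor (δ z m xor δ z y)   ≡⟨ xor-assoc (δ z x) (δ z m) _ ⟩
  δ z x xor (δ z m xor (δ z m xor δ z y))   ≡⟨ cong (δ z x xor_) (xor-cancel (δ z m) (δ z y)) ⟩
  δ z x xor δ z y                           ∎
  where open ≡-Reasoning

∂-touches : Ordered e → Touches z e → ∂ z e ≡ true
∂-touches {e = a , b} o (inj₁ refl) with a ≟ a | a ≟ b
... | no a≢a | _ = ⊥-elim (a≢a refl)
... | yes _ | no _ = refl
... | yes _ | yes refl = ⊥-elim (<-irrefl refl o)
∂-touches {e = a , b} o (inj₂ refl) with b ≟ a | b ≟ b
... | _ | no b≢b = ⊥-elim (b≢b refl)
... | no _ | yes _ = refl
... | yes refl | yes _ = ⊥-elim (<-irrefl refl o)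

∂-true⇒touches : (z : Fin v) (e : Edge v) → ∂ z e ≡ true → Touches z e
∂-true⇒touches z (a , b) eq with z ≟ a | z ≟ b
... | yes refl | _ = inj₁ refl
... | no _ | yes refl = inj₂ refl

data Path {v} : Fin v → Fin v → List (Fin v) → List (Edge v) → Set where
  single : Path x x (x ∷ []) []
  extend : Joins e y x → y ∉ vs → Path x z vs es → Path y z (y ∷ vs) (e ∷ es)

path⇒walk : Path x y vs es → Walk x y es
path⇒walk single = []
path⇒walk (extend j _ p) = j ∷ path⇒walk p

path-head∈ : Path x y vs es → x ∈ vs
path-head∈ single = here refl
path-head∈ (extend _ _ _) = here refl

path-length : Path x y vs es → length vs ≡ suc (length es)
path-length single = refl
path-length (extend _ _ p) = cong suc (path-length p)

path-vertices-unique : Path x y vs es → Unique vs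
path-vertices-unique single = [] ∷ []
path-vertices-unique (extend _ y∉ p) =
  All.tabulate (λ w∈ y≡w → y∉ (subst (_∈ _) (sym y≡w) w∈)) ∷ path-vertices-unique p

path-touched∈ : Path x y vs es → e ∈ es → Touches z e → z ∈ vs
path-touched∈ (extend (inj₁ refl) _ p) (here refl) (inj₁ refl) = here refl
path-touched∈ (extend (inj₁ refl) _ p) (here refl) (inj₂ refl) = there (path-head∈ p)
path-touched∈ (extend (inj₂ refl) _ p) (here refl) (inj₁ refl) = there (path-head∈ p)
path-touched∈ (extend (inj₂ refl) _ p) (here refl) (inj₂ refl) = here refl
path-touched∈ (extend _ _ p) (there e∈) t = there (path-touched∈ p e∈ t)

path-edges-unique : Path x y vs es → Unique es
path-edges-unique single = []
path-edges-unique (extend {e = e} j y∉ p) =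
  All.tabulate (λ f∈ e≡f → y∉ (path-touched∈ p (subst (_∈ _) (sym e≡f) f∈) (joins-touchesˡ j)))
  ∷ path-edges-unique p

-- The initial segment ending at `z` is what an edge from `z` back to the head closes to a cycle.
path-truncate : Path x y vs es → z ∈ vs → ∃ λ vs′ → ∃ λ es′ →
  Path x z vs′ es′ × All (_∈ vs) vs′ × All (_∈ es) es′
path-truncate single (here refl) = _ , _ , single , here refl ∷ [] , []
path-truncate (extend j y∉ p) (here refl) = _ , _ , single , here refl ∷ [] , []
path-truncate (extend j y∉ p) (there z∈) with path-truncate p z∈
... | vs′ , es′ , p′ , vs⊆ , es⊆ = _ , _ , extend j (λ y∈ → y∉ (All.lookup vs⊆ y∈)) p′
  , here refl ∷ All.map there vs⊆ , here refl ∷ All.map there es⊆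

-- A path together with an edge between its ends; `new` rules out going back along the only edge of
-- a path.
record SimpleCycle (us : List (Edge v)) : Set where
  field
    {start end} : Fin v
    {vertices}  : List (Fin v)
    {pathEdges} : List (Edge v)
    closing     : Edge v
    path        : Path start end vertices pathEdges
    closes      : Joins closing end start
    new         : closing ∉ pathEdges
    within      : All (_∈ us) (closing ∷ pathEdges)

  cycleEdges : List (Edge v)
  cycleEdges = closing ∷ pathEdges

  cycleEdges-unique : Unique cycleEdges
  cycleEdges-unique =
    All.tabulate (λ f∈ c≡f → new (subst (_∈ _) (sym c≡f) f∈)) ∷ path-edges-unique path

open SimpleCycle

weaken-cycle : All (_∈ fs) es → SimpleCycle es → SimpleCycle fs
weaken-cycle es⊆ C = record
  { closing = closing C ; path = path C ; closes = closes C ; new = new C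
  ; within = All.map (All.lookup es⊆) (within C) }

lookup-injective : {A : Set} {xs : List A} → Unique xs → ∀ {i j} → lookup xs i ≡ lookup xs j → i ≡ j
lookup-injective (_ ∷ _) {zero} {zero} _ = refl
lookup-injective {xs = x ∷ xs} (x∉ ∷ _) {zero} {suc j} eq = ⊥-elim (All.lookup x∉ (∈-lookup j) eq)
lookup-injective {xs = x ∷ xs} (x∉ ∷ _) {suc i} {zero} eq = ⊥-elim (All.lookup x∉ (∈-lookup i) (sym eq))
lookup-injective (_ ∷ u) {suc i} {suc j} eq = cong suc (lookup-injective u eq)

joins⇒adj : (G : Graph v) → e ∈ edges G → Joins e x y → Adj G x y
joins⇒adj G e∈ (inj₁ refl) = inj₁ e∈
joins⇒adj G e∈ (inj₂ refl) = inj₂ e∈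

path-adj : (G : Graph v) {x y a : Fin v} {as : List (Fin v)} → Path x y (a ∷ as) es → All (_∈ edges G) es →
  (j : Fin (length as)) → Adj G (lookup (a ∷ as) (inject₁ j)) (lookup as j)
path-adj G (extend j _ single) (e∈ ∷ _) zero = joins⇒adj G e∈ j
path-adj G (extend j _ (extend _ _ _)) (e∈ ∷ _) zero = joins⇒adj G e∈ j
path-adj G (extend _ _ p@(extend _ _ _)) (_ ∷ es∈) (suc i) = path-adj G p es∈ i

path-last : {x y a : Fin v} {as : List (Fin v)} → Path x y (a ∷ as) es → lookup (a ∷ as) (fromℕ (length as)) ≡ y
path-last single = refl
path-last (extend _ _ single) = refl
path-last (extend _ _ p@(extend _ _ _)) = path-last p

path-first : {x y a : Fin v} {as : List (Fin v)} → Path x y (a ∷ as) es → a ≡ x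
path-first single = refl
path-first (extend _ _ _) = refl

-- With one vertex the closing edge would be a loop. With two it would be parallel to the path edge,
-- hence equal to it, as both are ordered pairs.
cycle-length≥3 : (G : Graph v) (C : SimpleCycle (edges G)) → 3 ≤ length (vertices C)
cycle-length≥3 G C = go (path C) (closes C) (new C) (within C)
  where
  o : ∀ {e} → e ∈ edges G → Ordered e
  o = All.lookup (ordered G)
  go : ∀ {a b vs es e} → Path a b vs es → Joins e b a → e ∉ es → All (_∈ edges G) (e ∷ es) → 3 ≤ length vs
  go single j _ (e∈ ∷ _) = ⊥-elim (joins-irrefl (o e∈) j)
  go (extend j′ _ single) j e∉ (e∈ ∷ e′∈ ∷ _) =
    ⊥-elim (e∉ (here (joins-unique (o e∈) (o e′∈) j (flip-joins j′))))
  go (extend _ _ (extend _ _ p)) _ _ _ = s≤s (s≤s (subst (1 ≤_) (sym (path-length p)) (s≤s z≤n)))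

cycle-in-graph : (G : Graph v) (C : SimpleCycle (edges G)) → HasCycleOfLength G (length (vertices C))
cycle-in-graph G C = cycle-length≥3 G C , lookup (vertices C)
  , lookup-injective (path-vertices-unique (path C)) , adjacent (path C) (closes C) (within C)
  where
  adjacent : ∀ {a b vs es e} → Path a b vs es → Joins e b a → All (_∈ edges G) (e ∷ es) →
    ∀ i → Adj G (lookup vs i) (lookup vs (sucMod i))
  adjacent {vs = w ∷ ws} p j (e∈ ∷ es∈) i with view i
  ... | ‵fromℕ = subst (λ i′ → Adj G (lookup (w ∷ ws) (fromℕ _)) (lookup (w ∷ ws) i′)) (sym (sucMod-fromℕ (length ws)))
    (subst (λ t → Adj G t w) (sym (path-last p)) (subst (Adj G _) (sym (path-first p)) (joins⇒adj G e∈ j)))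
  ... | ‵inject₁ i′ = subst (λ i″ → Adj G (lookup (w ∷ ws) (inject₁ i′)) (lookup (w ∷ ws) i″)) (sym (sucMod-inject₁ i′))
    (path-adj G p es∈ i′)

NoLeaf : List (Edge v) → Set
NoLeaf us = ∀ {e z} → e ∈ us → Touches z e → ∃ λ e′ → e′ ∈ us × e′ ≢ e × Touches z e′

-- A path is prolonged at its head until the next vertex already lies on it.
noLeaf⇒cycle : All Ordered us → NoLeaf us → e ∈ us → SimpleCycle us
noLeaf⇒cycle {v} {us = us} {e = a , b} ord noLeaf e∈ =
  grow (length us) ≤-refl (extend (inj₁ refl) a∉ single) (e∈ ∷ [])
  where
  open import Data.List.Membership.DecPropositional (_≟_ {v}) using (_∈?_)
  a∉ : a ∉ b ∷ []
  a∉ (here a≡b) = <-irrefl (cong toℕ a≡b) (All.lookup ord e∈)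
  grow : ∀ {y z vs e es} fuel → length us ≤ length es + fuel →
    Path y z vs (e ∷ es) → All (_∈ us) (e ∷ es) → SimpleCycle us
  -- The path has one edge more than `es`, so without fuel it would have more distinct edges than
  -- `us`.
  grow {es = es} zero long p es⊆ =
    ⊥-elim (1+n≰n (≤-trans (⊆⇒length≤ (path-edges-unique p) es⊆) (subst (length us ≤_) (+-identityʳ _) long)))
  grow {y} {e = e} {es} (suc fuel) long p@(extend {vs = vs} j y∉ p₁) es⊆@(e∈ ∷ _)
    with noLeaf e∈ (joins-touchesˡ j)
  ... | e′ , e′∈ , e′≢e , t with other-end y e′ t
  ... | x , j′ with x ∈? (y ∷ vs)
  ... | no x∉ = grow fuel (subst (length us ≤_) (+-suc (length es) fuel) long) (extend (flip-joins j′) x∉ p) (e′∈ ∷ es⊆)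
  ... | yes x∈ with path-truncate p x∈
  ... | _ , es′ , p′ , _ , es′⊆ = record
    { closing = e′ ; path = p′ ; closes = flip-joins j′ ; new = e′∉ ∘ All.lookup es′⊆
    ; within = e′∈ ∷ All.map (All.lookup es⊆) es′⊆ }
    where
    -- The edge `e′` touches the head `y`, and `e` is the only edge of the path that does.
    e′∉ : e′ ∉ e ∷ es
    e′∉ (here e′≡e) = e′≢e e′≡e
    e′∉ (there e′∈) = y∉ (path-touched∈ p₁ e′∈ t)

-- Without `e` the degree of `z` is odd, so some other edge meets `z`.
even⇒noLeaf : All Ordered us → Unique us → (∀ z → parity (∂ z) us ≡ false) → NoLeaf us
even⇒noLeaf {us = us} ord u even {e} {z} e∈ t with ∈⇒↭∷ e∈
... | us′ , π with Unique-resp-↭ π u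
... | e∉ ∷ _ with parity-true (∂ z) us′ odd
  where
  odd : parity (∂ z) us′ ≡ true
  odd = sym (xor≡false⇒≡ true _ (trans (cong (_xor parity (∂ z) us′) (sym (∂-touches (All.lookup ord e∈) t)))
    (trans (sym (parity-↭ (∂ z) π)) (even z))))
... | e′ , e′∈ , odd′ = e′ , ∈-resp-↭ (↭-sym π) (there e′∈)
  , (λ e′≡e → All.lookup e∉ e′∈ (sym e′≡e)) , ∂-true⇒touches z e′ odd′

-- An even edge multiset below the girth cancels modulo 2, since otherwise its reduction has no leaf and so contains a cycle.
even-below-girth : ∀ {g} (G : Graph v) → GirthAtLeast G g → (es : List (Edge v)) → All (_∈ edges G) es →
  length es < g → (∀ z → parity (∂ z) es ≡ false) → ∀ φ → parity φ es ≡ false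
even-below-girth {g = g} G girth es es⊆ short even φ with reduce-mod-2 _≟ᵉ_ es
... | [] , _ , _ , _ , same = sym (same φ)
... | us@(e ∷ _) , u , us≤ , us⊆ , same = ⊥-elim (girth _ short′ (cycle-in-graph G (weaken-cycle us⊆G C)))
  where
  us⊆G = All.map (All.lookup es⊆) us⊆
  ord = All.map (All.lookup (ordered G)) us⊆G
  C = noLeaf⇒cycle ord (even⇒noLeaf ord u (λ z → trans (same (∂ z)) (even z))) (here refl)
  short′ : length (vertices C) < g
  short′ = ≤-trans (s≤s (≤-trans (≤-reflexive (path-length (path C)))
    (≤-trans (⊆⇒length≤ (cycleEdges-unique C) (within C)) us≤))) short

LeafAt : List (Edge v) → Fin v → Edge v → Set
LeafAt us z e = All (λ e′ → e′ ≡ e ⊎ ¬ Touches z e′) us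

leafAt? : (us : List (Edge v)) (z : Fin v) (e : Edge v) → Dec (LeafAt us z e)
leafAt? us z e = All.all? (λ e′ → (e′ ≟ᵉ e) ⊎-dec ¬? (touches? z e′)) us

¬leafAt⇒other : ¬ LeafAt us z e → ∃ λ e′ → e′ ∈ us × e′ ≢ e × Touches z e′
¬leafAt⇒other {us = us} {z = z} {e = e} ¬leaf
  with find (¬All⇒Any¬ (λ e′ → (e′ ≟ᵉ e) ⊎-dec ¬? (touches? z e′)) us ¬leaf)
... | e′ , e′∈ , ¬p = e′ , e′∈ , ¬p ∘ inj₁ , decidable-stable (touches? z e′) (¬p ∘ inj₂)

leaf? : (us : List (Edge v)) → (∃ λ e → ∃ λ z → e ∈ us × Touches z e × LeafAt us z e) ⊎ NoLeaf us
leaf? us with Any.any? (λ e → leafAt? us (proj₁ e) e ⊎-dec leafAt? us (proj₂ e) e) us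
... | yes p with find p
...   | e , e∈ , inj₁ l = inj₁ (e , _ , e∈ , inj₁ refl , l)
...   | e , e∈ , inj₂ l = inj₁ (e , _ , e∈ , inj₂ refl , l)
leaf? us | no ¬p = inj₂ λ
  { e∈ (inj₁ refl) → ¬leafAt⇒other (λ l → ¬p (lose e∈ (inj₁ l)))
  ; e∈ (inj₂ refl) → ¬leafAt⇒other (λ l → ¬p (lose e∈ (inj₂ l))) }

Covers : List (Fin v) → List (Edge v) → Set
Covers X es = ∀ {e z} → e ∈ es → Touches z e → z ∈ X

-- Deleting a leaf edge together with its end `z` lowers both counts by one, so the inequality
-- persists until no leaf is left.
dense⇒cycle : (X : List (Fin v)) (E : List (Edge v)) → All Ordered E → Unique E → Covers X E →
  0 < length E → length X ≤ length E → SimpleCycle E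
dense⇒cycle X E = go (length E) E X refl
  where
  go : ∀ {v} m (E : List (Edge v)) X → length E ≡ m → All Ordered E → Unique E → Covers X E →
    0 < m → length X ≤ length E → SimpleCycle E
  go (suc m) E@(e₀ ∷ _) X eq ord u cov _ dense with leaf? E
  ... | inj₂ noLeaf = noLeaf⇒cycle ord noLeaf (here refl)
  ... | inj₁ (e , z , e∈ , t , leaf) with ∈⇒↭∷ e∈ | ∈⇒↭∷ (cov e∈ t) | other-end z e t
  ... | E′ , π | X′ , ρ | x , j with Unique-resp-↭ π u
  ... | e∉ ∷ u′ = weaken-cycle (All.tabulate (∈-resp-↭ (↭-sym π) ∘ there))
      (go m E′ X′ eq′ (All.tail (All-resp-↭ π ord)) u′ cov′
        (≤-trans x<X′ (subst (length X′ ≤_) eq′ dense′)) dense′)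
    where
    eq′ : length E′ ≡ m
    eq′ = ℕ.suc-injective (trans (sym (↭-length π)) eq)
    dense′ : length X′ ≤ length E′
    dense′ = s≤s⁻¹ (subst (_≤ suc (length E′)) (↭-length ρ) (subst (length X ≤_) (↭-length π) dense))
    survives : ∀ {y} → y ∈ X → y ≢ z → y ∈ X′
    survives y∈ y≢z with ∈-resp-↭ ρ y∈
    ... | here y≡z = ⊥-elim (y≢z y≡z)
    ... | there y∈′ = y∈′
    -- The other end of the deleted edge remains, so the inequality also keeps `E′` nonempty.
    x<X′ : 0 < length X′
    x<X′ = ∈-length (survives (cov e∈ (joins-touchesˡ (flip-joins j)))
      (λ { refl → joins-irrefl (All.lookup ord e∈) j }))
    cov′ : Covers X′ E′
    cov′ {f} f∈ tf = survives (cov f∈E tf) λ { refl → bad (All.lookup leaf f∈E) tf }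
      where
      f∈E = ∈-resp-↭ (↭-sym π) (there f∈)
      bad : f ≡ e ⊎ ¬ Touches z f → ¬ Touches z f
      bad (inj₁ refl) _ = All.lookup e∉ f∈ refl
      bad (inj₂ ¬t) = ¬t

-- Distinctness of edges is stated separately, as `Unique` of the concatenated edge lists, which
-- also says that different trails are edge-disjoint.
record ClosedTrail (v : ℕ) : Set where
  constructor trail
  field
    {base}     : Fin v
    {trailEdges} : List (Edge v)
    closedWalk : Walk base base trailEdges
    nonempty   : 0 < length trailEdges

open ClosedTrail

edgesOf : List (ClosedTrail v) → List (Edge v)
edgesOf = concatMap trailEdges

-- As long as more than `v` edges remain, they contain a cycle, which is split off; `m` bounds the
-- recursion.
edge-disjoint-trails : (m : ℕ) (E : List (Edge v)) → length E ≤ m → All Ordered E → Unique E →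
  ∃ λ Cs → ∃ λ rest → E ↭ edgesOf Cs ++ rest × length rest ≤ v
edge-disjoint-trails {v} m E E≤m ord u with v <? length E
... | no v≮ = [] , E , ↭-refl , ≮⇒≥ v≮
edge-disjoint-trails zero [] E≤m ord u | yes ()
edge-disjoint-trails {v} (suc m) E E≤m ord u | yes v<
  with dense⇒cycle (allFin v) E ord u (λ _ _ → ∈-allFin _) (≤-trans (s≤s z≤n) v<)
    (≤-trans (≤-reflexive (length-tabulate id)) (<⇒≤ v<))
... | C with ⊆-complement (cycleEdges-unique C) (within C)
... | E′ , π with edge-disjoint-trails m E′ E′≤m (AllP.++⁻ʳ _ (All-resp-↭ π ord)) (Unique-++⁻ʳ _ (Unique-resp-↭ π u))
  where
  E′≤m : length E′ ≤ m
  E′≤m = s≤s⁻¹ (≤-trans (s≤s (m≤n+m (length E′) (length (pathEdges C))))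
    (≤-trans (≤-reflexive (sym (trans (↭-length π) (length-++ (cycleEdges C))))) E≤m))
... | Cs , rest , ρ , rest≤ = trail (closes C ∷ path⇒walk (path C)) (s≤s z≤n) ∷ Cs , rest
  , ↭-trans π (↭-trans (++⁺ˡ (cycleEdges C) ρ) (↭-reflexive (sym (++-assoc (cycleEdges C) _ rest)))) , rest≤

split-walk : Walk x y es → Any (Touches z) es → ∃ λ as → ∃ λ bs →
  es ≡ as ++ bs × Walk x z as × Walk z y bs
split-walk (inj₁ refl ∷ p) (here (inj₁ refl)) = [] , _ , refl , [] , (inj₁ refl ∷ p)
split-walk (inj₂ refl ∷ p) (here (inj₁ refl)) = _ ∷ [] , _ , refl , (inj₂ refl ∷ []) , p
split-walk (inj₁ refl ∷ p) (here (inj₂ refl)) = _ ∷ [] , _ , refl , (inj₁ refl ∷ []) , p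
split-walk (inj₂ refl ∷ p) (here (inj₂ refl)) = [] , _ , refl , [] , (inj₂ refl ∷ p)
split-walk (j ∷ p) (there t) with split-walk p t
... | as , bs , refl , p₁ , p₂ = _ ∷ as , bs , refl , (j ∷ p₁) , p₂

Visits : ClosedTrail v → Fin v → Set
Visits W z = Any (Touches z) (trailEdges W)

visits? : (W : ClosedTrail v) (z : Fin v) → Dec (Visits W z)
visits? W z = Any.any? (touches? z) (trailEdges W)

-- The second trail, rotated so that it starts and ends at `z`, is inserted into the first at a
-- visit to `z`.
splice : (W C : ClosedTrail v) → Visits W z → Visits C z →
  ∃ λ W′ → trailEdges W′ ↭ trailEdges W ++ trailEdges C
splice (trail w w>0) (trail c c>0) tw tc with split-walk w tw | split-walk c tc
... | as , bs , refl , p , q | cs , ds , refl , r , s =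
  trail (p ++ʷ ((s ++ʷ r) ++ʷ q)) (subst (0 <_) (sym (↭-length π))
    (≤-trans w>0 (≤-trans (m≤m+n _ _) (≤-reflexive (sym (length-++ (as ++ bs))))))) , π
  where
  π : as ++ (ds ++ cs) ++ bs ↭ (as ++ bs) ++ cs ++ ds
  π = ↭-trans (++⁺ˡ as (↭-trans (++-comm (ds ++ cs) bs) (++⁺ˡ bs (++-comm ds cs))))
    (↭-reflexive (sym (++-assoc as bs _)))

Meets : ClosedTrail v → ClosedTrail v → Set
Meets W C = ∃ λ z → Visits W z × Visits C z

-- Each merger uses up one trail. At the end no remaining trail shares a vertex with `W′`, so the
-- vertex set can be split between them.
absorb : (m : ℕ) (W : ClosedTrail v) (Cs : List (ClosedTrail v)) → length Cs ≤ m → ∃ λ W′ → ∃ λ Cs′ →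
  trailEdges W′ ++ edgesOf Cs′ ↭ trailEdges W ++ edgesOf Cs × length Cs′ ≤ length Cs × All (¬_ ∘ Meets W′) Cs′
absorb m W Cs Cs≤m with Any.any? (λ C → any? λ z → visits? W z ×-dec visits? C z) Cs
... | no ¬meets = W , Cs , ↭-refl , ≤-refl , ¬Any⇒All¬ Cs ¬meets
absorb zero W [] Cs≤m | yes ()
absorb (suc m) W Cs Cs≤m | yes meets with find meets
... | C , C∈ , z , tw , tc with ∈⇒↭∷ C∈ | splice W C tw tc
... | Ds , π | W₁ , ρ with absorb m W₁ Ds (s≤s⁻¹ (≤-trans (≤-reflexive (sym (↭-length π))) Cs≤m))
... | W′ , Cs′ , τ , Cs′≤ , apart = W′ , Cs′
  , ↭-trans τ (↭-trans (++⁺ʳ (edgesOf Ds) ρ) (↭-trans (↭-reflexive (++-assoc (trailEdges W) _ _))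
      (++⁺ˡ (trailEdges W) (↭-sym (concatMap-↭ trailEdges π)))))
  , ≤-trans Cs′≤ (≤-trans (n≤1+n _) (≤-reflexive (sym (↭-length π)))) , apart

-- If the trail grown from the first one is too sparse, dropping it together with its vertices raises the density of the rest.
dense-trail : (p q m : ℕ) (Cs : List (ClosedTrail v)) (X : List (Fin v)) → length Cs ≤ m →
  Unique (edgesOf Cs) → Covers X (edgesOf Cs) → q * length X < p * length (edgesOf Cs) →
  ∃ λ W → ∃ λ U → Unique (trailEdges W) × All (_∈ edgesOf Cs) (trailEdges W)
    × Covers U (trailEdges W) × q * length U ≤ p * length (trailEdges W)
-- The strict inequality excludes an empty list of trails.
dense-trail p q m [] X Cs≤m u cov dense = ⊥-elim (n≮0 (subst (q * length X <_) (*-zeroʳ p) dense))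
dense-trail p q (suc m) (C ∷ Cs) X (s≤s Cs≤m) u cov dense with absorb (length Cs) C Cs ≤-refl
... | W , Cs′ , π , Cs′≤ , apart with q * length (filter (visits? W) X) ≤? p * length (trailEdges W)
... | yes ok = W , filter (visits? W) X
  , Unique-++⁻ˡ _ (Unique-resp-↭ (↭-sym π) u) , All.tabulate (∈-resp-↭ π ∘ ∈-++⁺ˡ)
  , (λ e∈ t → ∈-filter⁺ (visits? W) (cov (∈-resp-↭ π (∈-++⁺ˡ e∈)) t) (lose e∈ t)) , ok
... | no sparse = let W′ , U , u′ , s , c , d = rec in W′ , U , u′
    , All.map (∈-resp-↭ π ∘ ∈-++⁺ʳ (trailEdges W)) s , c , d
  where
  X₁ = filter (visits? W) X
  X₂ = filter (¬? ∘ visits? W) X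
  cov′ : Covers X₂ (edgesOf Cs′)
  cov′ {e} {z} e∈ t = ∈-filter⁺ (¬? ∘ visits? W) (cov (∈-resp-↭ π (∈-++⁺ʳ (trailEdges W) e∈)) t)
    λ tw → let D , D∈ , e∈D = find (∈-concatMap⁻ trailEdges {xs = Cs′} e∈)
           in All.lookup apart D∈ (z , tw , lose e∈D t)
  dense′ : q * length X₂ < p * length (edgesOf Cs′)
  dense′ = +-cancelˡ-< (q * length X₁) _ _ (begin-strict
    q * length X₁ + q * length X₂                         ≡⟨ sym (*-distribˡ-+ q (length X₁) _) ⟩
    q * (length X₁ + length X₂)                           ≡⟨ cong (q *_) (sym (trans (↭-length (filter-split (visits? W) X)) (length-++ X₁))) ⟩
    q * length X                                          <⟨ dense ⟩
    p * length (edgesOf (C ∷ Cs))                         ≡⟨ cong (p *_) (trans (sym (↭-length π)) (length-++ (trailEdges W))) ⟩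
    p * (length (trailEdges W) + length (edgesOf Cs′))    ≡⟨ *-distribˡ-+ p (length (trailEdges W)) _ ⟩
    p * length (trailEdges W) + p * length (edgesOf Cs′)  ≤⟨ +-monoˡ-≤ _ (≰⇒≥ sparse) ⟩
    q * length X₁ + p * length (edgesOf Cs′)              ∎)
    where open ≤-Reasoning
  rec = dense-trail p q m Cs′ X₂ (≤-trans Cs′≤ Cs≤m) (Unique-++⁻ʳ (trailEdges W) (Unique-resp-↭ (↭-sym π) u)) cov′ dense′

-- The instance given by a closed trail

-- Bounded search; the default value `k`, returned when nothing smaller satisfies `P`, is the cap on
-- distances.
least : {P : ℕ → Set} → (∀ t → Dec (P t)) → ℕ → ℕ
least P? zero = 0
least P? (suc k) with P? 0
... | yes _ = 0
... | no _ = suc (least (P? ∘ suc) k)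

least≤ : {P : ℕ → Set} (P? : ∀ t → Dec (P t)) (k : ℕ) → least P? k ≤ k
least≤ P? zero = z≤n
least≤ P? (suc k) with P? 0
... | yes _ = z≤n
... | no _ = s≤s (least≤ (P? ∘ suc) k)

least-holds : {P : ℕ → Set} (P? : ∀ t → Dec (P t)) (k : ℕ) → least P? k < k → P (least P? k)
least-holds P? (suc k) l< with P? 0
... | yes p = p
least-holds P? (suc k) (s≤s l<) | no _ = least-holds (P? ∘ suc) k l<

least-minimal : {P : ℕ → Set} (P? : ∀ t → Dec (P t)) (k : ℕ) {t : ℕ} → P t → least P? k ≤ t
least-minimal P? zero p = z≤n
least-minimal P? (suc k) {t} p with P? 0
... | yes _ = z≤n
least-minimal P? (suc k) {zero} p | no ¬p = ⊥-elim (¬p p)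
least-minimal P? (suc k) {suc t} p | no _ = s≤s (least-minimal (P? ∘ suc) k p)

WalkIn : Graph v → ℕ → Fin v → Fin v → Set
WalkIn G d x y = ∃ λ es → Walk x y es × All (_∈ edges G) es × length es ≡ d

walkIn? : (G : Graph v) (d : ℕ) (x y : Fin v) → Dec (WalkIn G d x y)
walkIn? G zero x y = map′ (λ { refl → [] , [] , [] , refl }) (λ { ([] , [] , _ , _) → refl }) (x ≟ y)
walkIn? G (suc d) x y = map′ to from
  (any? λ m → Any.any? (λ e → (e ≟ᵉ (x , m)) ⊎-dec (e ≟ᵉ (m , x))) (edges G) ×-dec walkIn? G d m y)
  where
  to : (∃ λ m → Any (λ e → Joins e x m) (edges G) × WalkIn G d m y) → WalkIn G (suc d) x y
  to (m , a , es , p , es⊆ , eq) = let e , e∈ , j = find a in e ∷ es , j ∷ p , e∈ ∷ es⊆ , cong suc eq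
  from : WalkIn G (suc d) x y → ∃ λ m → Any (λ e → Joins e x m) (edges G) × WalkIn G d m y
  from (e ∷ es , j ∷ p , e∈ ∷ es⊆ , refl) = _ , lose e∈ j , es , p , es⊆ , refl

reverse-walkIn : (G : Graph v) {d : ℕ} → WalkIn G d x y → WalkIn G d y x
reverse-walkIn G (es , p , es⊆ , refl) = let fs , q , π = reverseʷ p in
  fs , q , All-resp-↭ (↭-sym π) es⊆ , ↭-length π

module CappedDistance (G : Graph v) (k : ℕ) where

  dist : Fin v → Fin v → ℕ
  dist x y = least (λ d → walkIn? G d x y) k

  dist≤cap : ∀ x y → dist x y ≤ k
  dist≤cap x y = least≤ (λ d → walkIn? G d x y) k

  dist-walk : ∀ x y → dist x y < k → WalkIn G (dist x y) x y
  dist-walk x y = least-holds (λ d → walkIn? G d x y) k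

  dist-minimal : ∀ {x y d} → WalkIn G d x y → dist x y ≤ d
  dist-minimal {x} {y} = least-minimal (λ d → walkIn? G d x y) k

  dist-refl : ∀ x → dist x x ≡ 0
  dist-refl x = n≤0⇒n≡0 (dist-minimal ([] , [] , [] , refl))

  dist-sym≤ : ∀ x y → dist x y ≤ dist y x
  dist-sym≤ x y with dist y x <? k
  ... | yes lt = dist-minimal (reverse-walkIn G (dist-walk y x lt))
  ... | no ≮ = ≤-trans (dist≤cap x y) (≮⇒≥ ≮)

  -- If the right side reaches the cap, nothing is to be shown. Otherwise both distances are
  -- attained by walks, which are concatenated.
  dist-tri : ∀ x y z → dist x z ≤ dist x y + dist y z
  dist-tri x y z with dist x y + dist y z <? k
  ... | no ≮ = ≤-trans (dist≤cap x z) (≮⇒≥ ≮)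
  ... | yes lt with dist-walk x y (≤-<-trans (m≤m+n _ _) lt) | dist-walk y z (≤-<-trans (m≤n+m _ (dist x y)) lt)
  ... | es , p , es⊆ , eq | fs , q , fs⊆ , eq′ =
    dist-minimal (es ++ fs , p ++ʷ q , AllP.++⁺ es⊆ fs⊆ , trans (length-++ es) (cong₂ _+_ eq eq′))

  labelMetric : (Fin n → Fin v) → Metric n
  labelMetric w = record
    { c = λ p q → dist (w p) (w q)
    ; diag = λ p → dist-refl (w p)
    ; sym = λ p q → ≤-antisym (dist-sym≤ (w p) (w q)) (dist-sym≤ (w q) (w p))
    ; tri = λ p q r → dist-tri (w p) (w q) (w r) }

-- Cyclic sums and walks spread over the positions of a tour

sumFin-sum : ∀ n (f : Fin n → ℕ) → sumFin n f ≡ sum (map f (allFin n))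
sumFin-sum n f = trans (go n f) (cong sum (sym (map-tabulate id f)))
  where
  go : ∀ n (f : Fin n → ℕ) → sumFin n f ≡ sum (tabulate f)
  go zero f = refl
  go (suc n) f = cong (f zero +_) (go n (f ∘ suc))

sumFin-cong : ∀ n {f g : Fin n → ℕ} → (∀ i → f i ≡ g i) → sumFin n f ≡ sumFin n g
sumFin-cong zero eq = refl
sumFin-cong (suc n) eq = cong₂ _+_ (eq zero) (sumFin-cong n (eq ∘ suc))

sumFin-last : ∀ n (f : Fin (suc n) → ℕ) → sumFin (suc n) f ≡ sumFin n (f ∘ inject₁) + f (fromℕ n)
sumFin-last zero f = +-comm (f zero) 0
sumFin-last (suc n) f = trans (cong (f zero +_) (sumFin-last n (f ∘ suc))) (sym (+-assoc (f zero) _ _))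

term≤sumFin : ∀ n (f : Fin n → ℕ) i → f i ≤ sumFin n f
term≤sumFin (suc n) f zero = m≤m+n _ _
term≤sumFin (suc n) f (suc i) = ≤-trans (term≤sumFin n (f ∘ suc) i) (m≤n+m _ (f zero))

sucMod-injective : Injective _≡_ _≡_ (sucMod {n})
sucMod-injective {n = suc m} {i} {j} eq with view i | view j
... | ‵fromℕ | ‵fromℕ = refl
... | ‵fromℕ | ‵inject₁ j′ with () ← trans (sym (sucMod-fromℕ m)) (trans eq (sucMod-inject₁ j′))
... | ‵inject₁ i′ | ‵fromℕ with () ← trans (sym (sucMod-inject₁ i′)) (trans eq (sucMod-fromℕ m))
... | ‵inject₁ i′ | ‵inject₁ j′ = cong inject₁ (suc-injective (trans (sym (sucMod-inject₁ i′)) (trans eq (sucMod-inject₁ j′))))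

-- This makes a tour edge determine its position: with two positions, both would carry the same pair
-- of ends.
sucMod²≢id : 3 ≤ n → (i : Fin n) → sucMod (sucMod i) ≢ i
sucMod²≢id {suc (suc (suc m))} (s≤s (s≤s (s≤s _))) i eq with view i
... | ‵fromℕ with () ← trans (sym eq) (trans (cong sucMod (sucMod-fromℕ (suc (suc m)))) (sucMod-inject₁ zero))
... | ‵inject₁ j with view j
...   | ‵fromℕ with () ← trans (sym eq) (trans (cong sucMod (sucMod-inject₁ (fromℕ (suc m)))) (sucMod-fromℕ (suc (suc m))))
...   | ‵inject₁ j′ = m≢1+n+m (toℕ j′) {1} (begin
    toℕ j′                                   ≡⟨ sym (trans (toℕ-inject₁ (inject₁ j′)) (toℕ-inject₁ j′)) ⟩
    toℕ (inject₁ (inject₁ j′))               ≡⟨ cong toℕ (sym eq) ⟩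
    toℕ (sucMod (sucMod (inject₁ (inject₁ j′)))) ≡⟨ cong (toℕ ∘ sucMod) (sucMod-inject₁ (inject₁ j′)) ⟩
    toℕ (sucMod (inject₁ (suc j′)))          ≡⟨ cong toℕ (sucMod-inject₁ (suc j′)) ⟩
    suc (suc (toℕ j′))                       ∎)
    where open ≡-Reasoning

-- Since `sucMod` permutes the positions, every value is counted twice: a closed tour has even
-- degrees.
parity-cyclic : (φ : Fin n → Bool) → parity (λ i → φ i xor φ (sucMod i)) (allFin n) ≡ false
parity-cyclic {n} φ = begin
  parity (λ i → φ i xor φ (sucMod i)) (allFin n)                 ≡⟨ parity-xor φ (φ ∘ sucMod) (allFin n) ⟩
  parity φ (allFin n) xor parity (φ ∘ sucMod) (allFin n)         ≡⟨ cong (parity φ (allFin n) xor_) (sym (parity-map φ sucMod (allFin n))) ⟩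
  parity φ (allFin n) xor parity φ (map sucMod (allFin n))       ≡⟨ cong (parity φ (allFin n) xor_) (sym (parity-↭ φ (injective⇒map↭ sucMod sucMod-injective))) ⟩
  parity φ (allFin n) xor parity φ (allFin n)                    ≡⟨ xor-same (parity φ (allFin n)) ⟩
  false                                                          ∎
  where open ≡-Reasoning

-- A walk stretched over exactly `n` steps of at most one edge each. The field `at-covers` carries a
-- property of the start and of all touched vertices to every position.
record WalkSequence {v} (n : ℕ) (x y : Fin v) (es : List (Edge v)) : Set₁ where
  field
    at        : Fin (suc n) → Fin v
    step      : Fin n → List (Edge v)
    at-first  : at zero ≡ x
    at-last   : at (fromℕ n) ≡ y
    stepWalk  : ∀ i → Walk (at (inject₁ i)) (at (suc i)) (step i)
    step≤1    : ∀ i → length (step i) ≤ 1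
    steps     : concatMap step (allFin n) ≡ es
    at-covers : {Q : Fin v → Set} → Q x → (∀ {e z} → e ∈ es → Touches z e → Q z) → ∀ i → Q (at i)

concatMap-allFin-suc : (f : Fin (suc n) → List A) →
  concatMap f (allFin (suc n)) ≡ f zero ++ concatMap (f ∘ suc) (allFin n)
concatMap-allFin-suc {n = n} f = cong (f zero ++_)
  (trans (cong (concatMap f) (sym (map-tabulate id suc))) (concatMap-map f suc (allFin n)))

prepend : {fs : List (Edge v)} → Walk x y fs → length fs ≤ 1 → WalkSequence n y z es → WalkSequence (suc n) x z (fs ++ es)
prepend {v} {x = x} {n = n} {fs = fs} p fs≤1 s = record
  { at = x Vector.∷ at ; step = fs Vector.∷ step ; at-first = refl ; at-last = at-last
  ; stepWalk = λ { zero → subst (λ t → Walk x t fs) (sym at-first) p ; (suc i) → stepWalk i }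
  ; step≤1 = λ { zero → fs≤1 ; (suc i) → step≤1 i }
  ; steps = trans (concatMap-allFin-suc (fs Vector.∷ step)) (cong (fs ++_) steps)
  ; at-covers = λ { {Q} Qx Qe zero → Qx
                  ; {Q} Qx Qe (suc i) → at-covers {Q} (walk-end p Qx (λ e∈ → Qe (∈-++⁺ˡ e∈))) (λ e∈ → Qe (∈-++⁺ʳ fs e∈)) i } }
  where
  open WalkSequence s
  walk-end : ∀ {x y gs} {Q : Fin v → Set} → Walk x y gs → Q x → (∀ {e z} → e ∈ gs → Touches z e → Q z) → Q y
  walk-end [] Qx _ = Qx
  walk-end (j ∷ q) _ Qe = walk-end q (Qe (here refl) (joins-touchesˡ (flip-joins j))) (Qe ∘ there)

walkSequence : ∀ n → Walk x y es → length es ≤ n → WalkSequence n x y es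
walkSequence zero [] _ = record
  { at = λ _ → _ ; step = λ () ; at-first = refl ; at-last = refl ; stepWalk = λ () ; step≤1 = λ ()
  ; steps = refl ; at-covers = λ Qx _ _ → Qx }
-- The walk is exhausted; the remaining steps are empty and stay at its end.
walkSequence (suc n) [] _ = prepend [] z≤n (walkSequence n [] z≤n)
walkSequence (suc n) (j ∷ p) (s≤s l) = prepend (j ∷ []) ≤-refl (walkSequence n p l)

-- Optimality under k-moves of the tour that follows the trail

idTour : Tour n
idTour = id , id

module TrailInstance {v n k : ℕ} (3≤n : 3 ≤ n) (G : Graph v) (girth : GirthAtLeast G (2 * k))
  (label : Fin n → Fin v) (step : Fin n → List (Edge v))
  (stepWalk : ∀ i → Walk (label i) (label (sucMod i)) (step i))
  (step≤1 : ∀ i → length (step i) ≤ 1)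
  (steps-unique : Unique (concatMap step (allFin n)))
  (steps⊆ : All (_∈ edges G) (concatMap step (allFin n))) where

  open CappedDistance G k

  M : Metric n
  M = labelMetric label

  step⊆ : ∀ i → All (_∈ edges G) (step i)
  step⊆ i = All.tabulate λ e∈ → All.lookup steps⊆ (∈-concatMap⁺ step (lose (∈-allFin i) e∈))

  stepCost : Fin n → ℕ
  stepCost i = dist (label i) (label (sucMod i))

  stepCost≤ : ∀ i → stepCost i ≤ length (step i)
  stepCost≤ i = dist-minimal (step i , stepWalk i , step⊆ i , refl)

  -- Below a positive cap, distance 0 is attained by the empty walk, but the ends of an edge of `G`
  -- differ. Hence a step along an edge costs at least 1.
  ≤stepCost : 0 < k → ∀ i → length (step i) ≤ stepCost i
  ≤stepCost 0<k i = go (stepWalk i) (step≤1 i) (step⊆ i)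
    where
    go : ∀ {x y es} → Walk x y es → length es ≤ 1 → All (_∈ edges G) es → length es ≤ dist x y
    go [] _ _ = z≤n
    go (_ ∷ (_ ∷ _)) (s≤s ()) _
    go {x} {y} (j ∷ []) _ (e∈ ∷ []) with dist x y in eq
    ... | suc _ = s≤s z≤n
    ... | zero with subst (λ d → WalkIn G d x y) eq (dist-walk x y (subst (_< k) (sym eq) 0<k))
    ... | [] , [] , _ , _ = ⊥-elim (joins-irrefl (All.lookup (ordered G) e∈) j)

  length-steps≤cost : 0 < k → length (concatMap step (allFin n)) ≤ cost M idTour
  length-steps≤cost 0<k = begin
    length (concatMap step (allFin n))       ≡⟨ length-concatMap step (allFin n) ⟩
    sum (map (length ∘ step) (allFin n))     ≤⟨ sum-mono (allFin n) (λ {i} _ → ≤stepCost 0<k i) ⟩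
    sum (map stepCost (allFin n))            ≡⟨ sym (sumFin-sum n stepCost) ⟩
    cost M idTour                            ∎
    where open ≤-Reasoning

  used-step : ∀ {e} → e ∈ concatMap step (allFin n) → ∃ λ i → 0 < length (step i)
  used-step e∈ = let i , _ , e∈i = find (∈-concatMap⁻ step {xs = allFin n} e∈) in i , ∈-length e∈i

  -- Positions outside `S` are matched by `σ` with positions of the new tour that have the same
  -- ends. They contribute equally to costs and parities, which leaves `removed` to be compared with
  -- `added`.
  kOptimal : KOptimal k M idTour
  kOptimal T′@(t , t-inj) (S , |S|≤k , kept) = ≮⇒≥ improving⇒⊥
    where
    open import Data.List.Membership.DecPropositional (_≟_ {n}) using (_∈?_)
    open import Data.List.Membership.DecPropositional (_≟ᵉ_ {v}) using () renaming (_∈?_ to _∈ᵉ?_)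

    Match : Fin n → Fin n → Set
    Match i j = (t j ≡ i × t (sucMod j) ≡ sucMod i) ⊎ (t j ≡ sucMod i × t (sucMod j) ≡ i)

    σ : Fin n → Fin n
    σ i with i ∈? S
    -- A dummy value: `σ` matters only outside `S`.
    ... | yes _ = i
    ... | no i∉ = proj₁ (kept i i∉)

    σ-match : ∀ {i} → i ∉ S → Match i (σ i)
    σ-match {i} i∉ with i ∈? S
    ... | yes i∈ = ⊥-elim (i∉ i∈)
    ... | no i∉′ = proj₂ (kept i i∉′)

    match-injective : ∀ {i i′ j} → Match i j → Match i′ j → i ≡ i′
    match-injective (inj₁ (p , _)) (inj₁ (q , _)) = trans (sym p) q
    match-injective (inj₂ (_ , p)) (inj₂ (_ , q)) = trans (sym p) q
    -- Opposite orientations would make two applications of `sucMod` return to `i`.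
    match-injective {i} {i′} (inj₁ (p , p′)) (inj₂ (q , q′)) =
      ⊥-elim (sucMod²≢id 3≤n i (trans (cong sucMod (trans (sym p′) q′)) (trans (sym q) p)))
    match-injective {i} {i′} (inj₂ (p , p′)) (inj₁ (q , q′)) =
      ⊥-elim (sucMod²≢id 3≤n i (trans (cong sucMod (trans (sym p) q)) (trans (sym q′) p′)))

    newCost : Fin n → ℕ
    newCost j = dist (label (t j)) (label (t (sucMod j)))

    oldEnds newEnds : Fin v → Fin n → Bool
    oldEnds z i = δ z (label i) xor δ z (label (sucMod i))
    newEnds z j = δ z (label (t j)) xor δ z (label (t (sucMod j)))

    match-cost : ∀ {i j} → Match i j → newCost j ≡ stepCost i
    match-cost (inj₁ (p , q)) = cong₂ (λ a b → dist (label a) (label b)) p q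
    match-cost {i} (inj₂ (p , q)) =
      trans (cong₂ (λ a b → dist (label a) (label b)) p q) (Metric.sym M (sucMod i) i)

    match-ends : ∀ z {i j} → Match i j → newEnds z j ≡ oldEnds z i
    match-ends z (inj₁ (p , q)) = cong₂ (λ a b → δ z (label a) xor δ z (label b)) p q
    match-ends z {i} (inj₂ (p , q)) = trans (cong₂ (λ a b → δ z (label a) xor δ z (label b)) p q)
      (xor-comm (δ z (label (sucMod i))) (δ z (label i)))

    removed unchanged : List (Fin n)
    removed = filter (_∈? S) (allFin n)
    unchanged = filter (¬? ∘ (_∈? S)) (allFin n)

    old-split : allFin n ↭ removed ++ unchanged
    old-split = filter-split (_∈? S) (allFin n)

    ∉S : ∀ {i} → i ∈ unchanged → i ∉ S
    ∉S i∈ = proj₂ (∈-filter⁻ (¬? ∘ (_∈? S)) {xs = allFin n} i∈)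

    |removed|≤k : length removed ≤ k
    |removed|≤k = ≤-trans (⊆⇒length≤ (Unique.filter⁺ (_∈? S) (allFin⁺ n)) (AllP.all-filter (_∈? S) (allFin n))) |S|≤k

    added-split : ∃ λ added → allFin n ↭ map σ unchanged ++ added
    added-split = ⊆-complement
      (Unique-map-local σ (λ {i} {i′} p q eq → match-injective (σ-match (∉S p)) (subst (Match i′) (sym eq) (σ-match (∉S q))))
        (Unique.filter⁺ (¬? ∘ (_∈? S)) (allFin⁺ n)))
      (All.tabulate (λ {j} _ → ∈-allFin j))

    added : List (Fin n)
    added = proj₁ added-split

    new-split : allFin n ↭ map σ unchanged ++ added
    new-split = proj₂ added-split

    unchangedCost : ℕ
    unchangedCost = sum (map stepCost unchanged)

    old-cost : cost M idTour ≡ sum (map stepCost removed) + unchangedCost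
    old-cost = trans (sumFin-sum n stepCost) (trans (sum-map-↭ stepCost old-split) (sum-map-++ stepCost removed unchanged))

    new-cost : cost M T′ ≡ sum (map newCost added) + unchangedCost
    new-cost = begin
      cost M T′                                                          ≡⟨ sumFin-sum n newCost ⟩
      sum (map newCost (allFin n))                                       ≡⟨ sum-map-↭ newCost new-split ⟩
      sum (map newCost (map σ unchanged ++ added))                       ≡⟨ sum-map-++ newCost (map σ unchanged) added ⟩
      sum (map newCost (map σ unchanged)) + sum (map newCost added)      ≡⟨ cong (_+ sum (map newCost added)) same ⟩
      unchangedCost + sum (map newCost added)                            ≡⟨ +-comm unchangedCost _ ⟩
      sum (map newCost added) + unchangedCost                            ∎
      where
      open ≡-Reasoning
      same : sum (map newCost (map σ unchanged)) ≡ unchangedCost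
      same = cong sum (trans (sym (map-∘ unchanged)) (map-cong-local (All.tabulate (match-cost ∘ σ-match ∘ ∉S))))

    newWalk : ∀ j → ∃ λ es → newCost j < k →
      Walk (label (t j)) (label (t (sucMod j))) es × All (_∈ edges G) es × length es ≡ newCost j
    newWalk j with newCost j <? k
    ... | yes lt = let es , w = dist-walk _ _ lt in es , λ _ → w
    -- At the cap there may be no walk; an improving move never reaches this case.
    ... | no ≮ = [] , λ lt → ⊥-elim (≮ lt)

    removedEdges addedEdges : List (Edge v)
    removedEdges = concatMap step removed
    addedEdges = concatMap (proj₁ ∘ newWalk) added

    steps-split : concatMap step (allFin n) ↭ removedEdges ++ concatMap step unchanged
    steps-split = ↭-trans (concatMap-↭ step old-split) (↭-reflexive (concatMap-++ step removed unchanged))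

    removedEdges-unique : Unique removedEdges
    removedEdges-unique = Unique-++⁻ˡ removedEdges (Unique-resp-↭ steps-split steps-unique)

    removedEdges⊆ : All (_∈ edges G) removedEdges
    removedEdges⊆ = AllP.++⁻ˡ removedEdges (All-resp-↭ steps-split steps⊆)

    removedCost≤ : sum (map stepCost removed) ≤ length removedEdges
    removedCost≤ = ≤-trans (sum-mono removed (λ {i} _ → stepCost≤ i)) (≤-reflexive (sym (length-concatMap step removed)))

    |removedEdges|≤k : length removedEdges ≤ k
    |removedEdges|≤k = begin
      length removedEdges                   ≡⟨ length-concatMap step removed ⟩
      sum (map (length ∘ step) removed)     ≤⟨ sum-mono removed (λ {i} _ → step≤1 i) ⟩
      sum (map (λ _ → 1) removed)           ≡⟨ sum-map-const-1 removed ⟩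
      length removed                        ≤⟨ |removed|≤k ⟩
      k                                     ∎
      where open ≤-Reasoning

    improving⇒⊥ : cost M T′ < cost M idTour → ⊥
    improving⇒⊥ improving = <-irrefl refl (begin-strict
      length removedEdges              ≤⟨ ⊆⇒length≤ removedEdges-unique (All.tabulate removed⇒added) ⟩
      length addedEdges                ≡⟨ |addedEdges| ⟩
      sum (map newCost added)          <⟨ cheaper ⟩
      sum (map stepCost removed)       ≤⟨ removedCost≤ ⟩
      length removedEdges              ∎)
      where
      open ≤-Reasoning
      cheaper : sum (map newCost added) < sum (map stepCost removed)
      cheaper = +-cancelʳ-< unchangedCost _ _ (subst₂ _<_ new-cost old-cost improving)

      -- All added edges together cost less than the removed ones, hence less than `k`, so each of
      -- them is realised by a shortest walk.
      below-cap : ∀ {j} → j ∈ added → newCost j < k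
      below-cap j∈ = ≤-<-trans (sum-map-∈ newCost j∈)
        (<-≤-trans cheaper (≤-trans removedCost≤ |removedEdges|≤k))

      |addedEdges| : length addedEdges ≡ sum (map newCost added)
      |addedEdges| = trans (length-concatMap (proj₁ ∘ newWalk) added)
        (cong sum (map-cong-local (All.tabulate λ {j} j∈ → proj₂ (proj₂ (proj₂ (newWalk j) (below-cap j∈))))))

      addedEdges⊆ : All (_∈ edges G) addedEdges
      addedEdges⊆ = All.tabulate λ e∈ →
        let j , j∈ , e∈j = find (∈-concatMap⁻ (proj₁ ∘ newWalk) {xs = added} e∈)
        in All.lookup (proj₁ (proj₂ (proj₂ (newWalk j) (below-cap j∈)))) e∈j

      -- At most `k` edges are removed, and the gain makes the added walks strictly shorter than `k`
      -- in total.
      short : length (removedEdges ++ addedEdges) < 2 * k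
      short = begin-strict
        length (removedEdges ++ addedEdges)          ≡⟨ length-++ removedEdges ⟩
        length removedEdges + length addedEdges      ≡⟨ cong (length removedEdges +_) |addedEdges| ⟩
        length removedEdges + sum (map newCost added) <⟨ +-mono-≤-< |removedEdges|≤k (<-≤-trans cheaper (≤-trans removedCost≤ |removedEdges|≤k)) ⟩
        k + k                                        ≡⟨ cong (k +_) (sym (+-identityʳ k)) ⟩
        2 * k                                        ∎

      -- Both tours are closed, so the removed and the added part each have the parity of the
      -- unchanged part.
      even : ∀ z → parity (∂ z) (removedEdges ++ addedEdges) ≡ false
      even z = ≡R.begin
        parity (∂ z) (removedEdges ++ addedEdges)                 ≡R.≡⟨ parity-++ (∂ z) removedEdges addedEdges ⟩
        parity (∂ z) removedEdges xor parity (∂ z) addedEdges     ≡R.≡⟨ cong₂ _xor_ old-parity new-parity ⟩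
        parity (oldEnds z) unchanged xor parity (oldEnds z) unchanged  ≡R.≡⟨ xor-same (parity (oldEnds z) unchanged) ⟩
        false                                                     ≡R.∎
        where
        module ≡R = ≡-Reasoning
        old-parity : parity (∂ z) removedEdges ≡ parity (oldEnds z) unchanged
        old-parity = trans (parity-concatMap (∂ z) step removed)
          (trans (parity-cong removed (λ {i} _ → parity-walk z (stepWalk i)))
            (xor≡false⇒≡ _ _ (trans (sym (parity-++ (oldEnds z) removed unchanged))
              (trans (sym (parity-↭ (oldEnds z) old-split)) (parity-cyclic (δ z ∘ label))))))
        unchanged-parity : parity (newEnds z) (map σ unchanged) ≡ parity (oldEnds z) unchanged
        unchanged-parity = trans (parity-map (newEnds z) σ unchanged) (parity-cong unchanged (match-ends z ∘ σ-match ∘ ∉S))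
        new-parity : parity (∂ z) addedEdges ≡ parity (oldEnds z) unchanged
        new-parity = trans (parity-concatMap (∂ z) (proj₁ ∘ newWalk) added)
          (trans (parity-cong added (λ {j} j∈ → parity-walk z (proj₁ (proj₂ (newWalk j) (below-cap j∈)))))
            (trans (sym (xor≡false⇒≡ _ _ (trans (sym (parity-++ (newEnds z) (map σ unchanged) added))
              (trans (sym (parity-↭ (newEnds z) new-split)) (parity-cyclic (δ z ∘ label ∘ t)))))) unchanged-parity))

      -- The trail uses `e` only once, so without a copy among the added edges it could not cancel.
      odd : ∀ {e} → e ∈ removedEdges → e ∉ addedEdges →
        parity (λ f → does (e ≟ᵉ f)) (removedEdges ++ addedEdges) ≡ true
      odd e∈ e∉ = trans (parity-++ _ removedEdges addedEdges)
        (cong₂ _xor_ (parity-indicator-∈ _≟ᵉ_ removedEdges-unique e∈) (parity-indicator-∉ _≟ᵉ_ e∉))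

      removed⇒added : ∀ {e} → e ∈ removedEdges → e ∈ addedEdges
      removed⇒added {e} e∈ with e ∈ᵉ? addedEdges
      ... | yes e∈′ = e∈′
      ... | no e∉ with () ← trans (sym (odd e∈ e∉))
        (even-below-girth G girth _ (AllP.++⁺ removedEdges⊆ addedEdges⊆) short even _)

-- Existence of optimal tours and positivity of their cost

-- The search chooses the values one at a time. Rebuilding a function from its values gives it only
-- up to pointwise equality, which `P` is therefore assumed to respect.
funSearch : ∀ m n (P : (Fin m → Fin n) → Set) → (∀ f → Dec (P f)) →
  (∀ {f g} → (∀ i → f i ≡ g i) → P f → P g) → Dec (∃ P)
funSearch zero n P P? resp = map′ (λ p → none , p) (λ { (f , p) → resp (λ ()) p }) (P? none)
  where
  none : Fin 0 → Fin n
  none ()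
funSearch (suc m) n P P? resp = map′
  (λ { (a , f , p) → a Vector.∷ f , p })
  (λ { (f , p) → f zero , f ∘ suc , resp (λ { zero → refl ; (suc i) → refl }) p })
  (any? λ a → funSearch m n (λ f → P (a Vector.∷ f)) (λ f → P? (a Vector.∷ f))
    (λ eq → resp (λ { zero → refl ; (suc i) → eq i })))

injective? : (f : Fin n → Fin n) → Dec (Injective _≡_ _≡_ f)
injective? f = map′ (λ inj → inj _ _) (λ inj _ _ → inj)
  (all? λ x → all? λ y → (f x ≟ f y) →-dec (x ≟ y))

better? : (M : Metric n) (b : ℕ) → Dec (∃ λ T → cost M T < b)
better? {n} M b = map′ to from (funSearch n n Better dec resp)
  where
  Better : (Fin n → Fin n) → Set
  Better f = Injective _≡_ _≡_ f × sumFin n (λ i → c M (f i) (f (sucMod i))) < b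
  dec : ∀ f → Dec (Better f)
  dec f = injective? f ×-dec (_ <? b)
  resp : ∀ {f g} → (∀ i → f i ≡ g i) → Better f → Better g
  resp eq (inj , lt) = (λ p → inj (trans (eq _) (trans p (sym (eq _)))))
    , subst (_< b) (sumFin-cong n (λ i → cong₂ (c M) (eq i) (eq (sucMod i)))) lt
  to : ∃ Better → ∃ λ T → cost M T < b
  to (f , p , lt) = (f , p) , lt
  from : (∃ λ T → cost M T < b) → ∃ Better
  from ((f , p) , lt) = f , p , lt

-- Strict descent from the identity tour; costs are natural numbers, so it ends at an optimum.
optimalTour : (M : Metric n) → ∃ (OptimalTour M)
optimalTour M = go (cost M idTour) idTour ≤-refl
  where
  go : ∀ m T → cost M T ≤ m → ∃ (OptimalTour M)
  go m T T≤m with better? M (cost M T)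
  ... | no ¬better = T , λ T′ → ≮⇒≥ λ lt → ¬better (T′ , lt)
  go zero T T≤m | yes (T′ , lt) = ⊥-elim (n≮0 (<-≤-trans lt T≤m))
  go (suc m) T T≤m | yes (T′ , lt) = go m T′ (s≤s⁻¹ (≤-trans lt T≤m))

-- A tour of cost 0 would put every city at distance 0 from its start, and then `p` at distance 0
-- from `q`.
tour-cost-positive : (M : Metric n) {p q : Fin n} → 0 < c M p q → (T : Tour n) → 0 < cost M T
tour-cost-positive {suc m} M {p} {q} 0<c T@(t , t-inj) = n≢0⇒n>0 λ cost≡0 → <⇒≱ 0<c (begin
    c M p q                              ≤⟨ tri M p (t zero) q ⟩
    c M p (t zero) + c M (t zero) q      ≡⟨ cong₂ _+_ (trans (Metric.sym M p (t zero)) (from-start cost≡0 p)) (from-start cost≡0 q) ⟩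
    0                                    ∎)
  where
  open ≤-Reasoning
  from-start : cost M T ≡ 0 → ∀ r → c M (t zero) r ≡ 0
  from-start cost≡0 r with ∈-map⁻ t (∈-resp-↭ (injective⇒map↭ t t-inj) (∈-allFin r))
  ... | i , _ , refl = <-weakInduction (λ i → c M (t zero) (t i) ≡ 0) (diag M (t zero)) advance i
    where
    advance : ∀ j → c M (t zero) (t (inject₁ j)) ≡ 0 → c M (t zero) (t (suc j)) ≡ 0
    advance j ih = n≤0⇒n≡0 (begin
      c M (t zero) (t (suc j))                                                     ≤⟨ tri M (t zero) (t (inject₁ j)) _ ⟩
      c M (t zero) (t (inject₁ j)) + c M (t (inject₁ j)) (t (suc j))               ≡⟨ cong₂ _+_ ih (cong (c M (t (inject₁ j)) ∘ t) (sym (sucMod-inject₁ j))) ⟩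
      c M (t (inject₁ j)) (t (sucMod (inject₁ j)))                                 ≤⟨ term≤sumFin (suc m) (λ i → c M (t i) (t (sucMod i))) (inject₁ j) ⟩
      cost M T                                                                     ≡⟨ cost≡0 ⟩
      0                                                                            ∎)

-- Cheap tours that visit one label class after another

chain : (A → A → ℕ) → A → List A → A → ℕ
chain d a [] b = d a b
chain d a (x ∷ xs) b = d a x + chain d x xs b

cyclic-sum : (d : A → A → ℕ) (x : A) (xs : List A) →
  sumFin (length (x ∷ xs)) (λ i → d (lookup (x ∷ xs) i) (lookup (x ∷ xs) (sucMod i))) ≡ chain d x xs x
cyclic-sum d x xs = begin
  sumFin (suc m) (λ i → d (at i) (at (sucMod i)))                                        ≡⟨ sumFin-last m (λ i → d (at i) (at (sucMod i))) ⟩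
  sumFin m (λ i → d (at (inject₁ i)) (at (sucMod (inject₁ i)))) + d (at (fromℕ m)) (at (sucMod (fromℕ m)))
    ≡⟨ cong₂ _+_ (sumFin-cong m (λ i → cong (d (at (inject₁ i)) ∘ at) (sucMod-inject₁ i))) (cong (d (at (fromℕ m)) ∘ at) (sucMod-fromℕ m)) ⟩
  sumFin m (λ i → d (at (inject₁ i)) (lookup xs i)) + d (at (fromℕ m)) x                 ≡⟨ go x xs x ⟩
  chain d x xs x                                                                         ∎
  where
  open ≡-Reasoning
  m = length xs
  at = lookup (x ∷ xs)
  go : ∀ x xs b → sumFin (length xs) (λ i → d (lookup (x ∷ xs) (inject₁ i)) (lookup xs i))
    + d (lookup (x ∷ xs) (fromℕ (length xs))) b ≡ chain d x xs b
  go x [] b = refl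
  go x (y ∷ ys) b = trans (+-assoc (d x y) _ _) (cong (d x y +_) (go y ys b))

list⇒cyclic : {m : ℕ} (d : A → A → ℕ) (x : A) (xs : List A) → length (x ∷ xs) ≡ m → Unique (x ∷ xs) →
  ∃ λ (f : Fin m → A) → Injective _≡_ _≡_ f × sumFin m (λ i → d (f i) (f (sucMod i))) ≡ chain d x xs x
list⇒cyclic d x xs refl u = lookup (x ∷ xs) , lookup-injective u , cyclic-sum d x xs

-- Visiting the positions label by label pays the cap only when the label changes.
module Grouping {k : ℕ} (M : Metric n) (label : Fin n → Fin v)
  (capped : ∀ p q → c M p q ≤ k) (same-label : ∀ {p q} → label p ≡ label q → c M p q ≡ 0) where

  chain-group : ∀ {B x a b} (fs L : List (Fin n)) → (∀ a → chain (c M) a L b ≤ B) →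
    label a ≡ x → All (λ p → label p ≡ x) fs → chain (c M) a (fs ++ L) b ≤ B
  chain-group [] L bound _ _ = bound _
  chain-group {B} {b = b} (f ∷ fs) L bound eq (eq′ ∷ eqs) =
    subst (λ t → t + chain (c M) f (fs ++ L) b ≤ B) (sym (same-label (trans eq (sym eq′)))) (chain-group fs L bound eq′ eqs)

  -- The cost is at most `k` on entering each label class and `k` once more on the way to `b`, hence
  -- the `suc`. Uniformity in `a` lets the list follow any preceding class.
  grouped : (U : List (Fin v)) (ps : List (Fin n)) → All (λ p → label p ∈ U) ps →
    ∃ λ L → ps ↭ L × (∀ a b → chain (c M) a L b ≤ k * suc (length U))
  grouped [] [] _ = [] , ↭-refl , λ a b → ≤-trans (capped a b) (≤-reflexive (sym (*-identityʳ k)))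
  grouped [] (p ∷ ps) (() ∷ _)
  grouped (x ∷ U) ps ps⊆ with grouped U (filter (¬? ∘ P?) ps) rest⊆
    where
    P? = λ p → label p ≟ x
    rest⊆ : All (λ p → label p ∈ U) (filter (¬? ∘ P?) ps)
    rest⊆ = All.tabulate λ {p} p∈ → let p∈ps , ≢x = ∈-filter⁻ (¬? ∘ P?) {xs = ps} p∈ in elsewhere (All.lookup ps⊆ p∈ps) ≢x
      where
      elsewhere : ∀ {p} → label p ∈ x ∷ U → label p ≢ x → label p ∈ U
      elsewhere (here eq) ≢x = ⊥-elim (≢x eq)
      elsewhere (there p∈) _ = p∈
  ... | L , π , bound = filter P? ps ++ L , ↭-trans (filter-split P? ps) (++⁺ˡ (filter P? ps) π)
    , λ a b → go (filter P? ps) (AllP.all-filter P? ps) a b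
    where
    P? = λ p → label p ≟ x
    go : ∀ fs → All (λ p → label p ≡ x) fs → ∀ a b → chain (c M) a (fs ++ L) b ≤ k * suc (suc (length U))
    go [] _ a b = ≤-trans (bound a b) (*-monoʳ-≤ k (n≤1+n _))
    go (f ∷ fs) (eq ∷ eqs) a b = begin
      c M a f + chain (c M) f (fs ++ L) b   ≤⟨ +-mono-≤ (capped a f) (chain-group fs L (λ a → bound a b) eq eqs) ⟩
      k + k * suc (length U)                ≡⟨ sym (*-suc k (suc (length U))) ⟩
      k * suc (suc (length U))              ∎
      where open ≤-Reasoning

  cheap-tour : 0 < n → (U : List (Fin v)) → (∀ p → label p ∈ U) → ∃ λ T → cost M T ≤ k * suc (length U)
  cheap-tour 0<n U label∈ with grouped U (allFin n) (All.tabulate (λ {p} _ → label∈ p))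
  ... | [] , π , _ = ⊥-elim (<-irrefl (trans (sym (↭-length π)) (length-tabulate id)) 0<n)
  ... | p ∷ L , π , bound with list⇒cyclic (c M) p L (trans (sym (↭-length π)) (length-tabulate id)) (Unique-resp-↭ π (allFin⁺ n))
  ... | t , t-inj , eq = (t , t-inj) , subst (_≤ k * suc (length U)) (sym eq) (≤-trans (m≤n+m _ (c M p p)) (bound p p))

-- The sparse and the dense case

lineMetric : ∀ n → Metric n
lineMetric n = record
  { c = λ p q → ∣ toℕ p - toℕ q ∣
  ; diag = λ p → ∣n-n∣≡0 (toℕ p)
  ; sym = λ p q → ∣-∣-comm (toℕ p) (toℕ q)
  ; tri = λ p q r → ∣-∣-triangle (toℕ p) (toℕ q) (toℕ r) }

-- At most `v` of more than `2 * v` edges are left over, so over half lie on trails. With `m` edges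
-- in all, the trails then have more than `m / 2v` edges per vertex, and some merged trail attains
-- this ratio.
graph-dense-trail : ∀ {v} (G : Graph v) → 2 * v < length (edges G) →
  ∃ λ W → ∃ λ U → Unique (trailEdges W) × All (_∈ edges G) (trailEdges W)
    × Covers U (trailEdges W) × length (edges G) * length U ≤ 2 * v * length (trailEdges W)
graph-dense-trail {v} G 2v<m with edges G in eq
graph-dense-trail {zero} G 2v<m | (() , _) ∷ _
graph-dense-trail {v@(suc _)} G 2v<m | E
  with edge-disjoint-trails (length E) E ≤-refl (subst (All Ordered) eq (ordered G)) (subst Unique eq (unique G))
... | Cs , rest , π , rest≤v = let W , U , u , W⊆ , cov , bound = found in
  W , U , u , All.map (∈-resp-↭ (↭-sym π) ∘ ∈-++⁺ˡ) W⊆ , cov , bound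
  where
  open ≤-Reasoning
  m = length E
  t = length (edgesOf Cs)
  r = length rest
  m≡t+r : m ≡ t + r
  m≡t+r = trans (↭-length π) (length-++ (edgesOf Cs))
  r<t : r < t
  r<t = +-cancelʳ-< r _ _ (begin-strict
    r + r   ≤⟨ +-mono-≤ rest≤v rest≤v ⟩
    v + v   ≡⟨ cong (v +_) (sym (+-identityʳ v)) ⟩
    2 * v   <⟨ 2v<m ⟩
    m       ≡⟨ m≡t+r ⟩
    t + r   ∎)
  dense : m * length (allFin v) < 2 * v * t
  dense = begin-strict
    m * length (allFin v)   ≡⟨ cong (m *_) (length-tabulate id) ⟩
    m * v                   ≡⟨ *-comm m v ⟩
    v * m                   ≡⟨ cong (v *_) m≡t+r ⟩
    v * (t + r)             <⟨ *-monoʳ-< v (+-monoʳ-< t r<t) ⟩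
    v * (t + t)             ≡⟨ *-distribˡ-+ v t t ⟩
    v * t + v * t           ≡⟨ sym (*-distribʳ-+ t v v) ⟩
    (v + v) * t             ≡⟨ cong (λ a → (v + a) * t) (sym (+-identityʳ v)) ⟩
    2 * v * t               ∎
  -- The arguments encode the target density of `m` edges per `2 * v` vertices.
  found = dense-trail (2 * v) m (length Cs) Cs (allFin v) ≤-refl
    (Unique-++⁻ˡ _ (Unique-resp-↭ π (subst Unique eq (unique G)))) (λ _ _ → ∈-allFin _) dense

base-visited : ∀ {v} (W : ClosedTrail v) → Visits W (base W)
base-visited (trail [] ())
base-visited (trail (j ∷ _) _) = here (joins-touchesˡ j)

-- The final inequality says that the ratio is at least `(a / b) * (n / v)`, cleared of
-- denominators.
HasBadTour : (k a b n v : ℕ) → Set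
HasBadTour k a b n v = Σ (Metric n) λ M → Σ (Tour n) λ T → KOptimal k M T ×
  Σ (Tour n) λ Topt → OptimalTour M Topt × 0 < cost M Topt × a * n * cost M Topt ≤ b * v * cost M T

-- Here `n / (4kv)` is at most 1, so ratio 1 suffices, and an optimal tour is k-optimal. Points on a
-- line make the cost positive.
sparse-case : ∀ {k n v} → 2 ≤ k → 3 ≤ n → n ≤ 2 * v → HasBadTour k 1 (4 * k) n v
sparse-case {k} {n@(suc (suc _))} {v} 2≤k (s≤s (s≤s _)) n≤2v with optimalTour (lineMetric n)
... | T , opt = lineMetric n , T , (λ T′ _ → opt T′) , T , opt
  , tour-cost-positive (lineMetric n) {zero} {suc zero} (s≤s z≤n) T
  , *-monoˡ-≤ (cost (lineMetric n) T) (begin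
      1 * n       ≡⟨ *-identityˡ n ⟩
      n           ≤⟨ n≤2v ⟩
      2 * v       ≤⟨ *-monoˡ-≤ v (≤-trans 2≤k (m≤n*m k 4)) ⟩
      4 * k * v   ∎)
  where open ≤-Reasoning

-- The bad tour costs at least the number `m` of trail edges, an optimal one at most `2k` per vertex
-- in `U`. Since `m` is at least `n / 2v` times the size of `U`, the ratio is at least `n / (4kv)`.
dense-case : ∀ {k n v} → 2 ≤ k → 3 ≤ n → (G : Graph v) → length (edges G) ≡ n →
  GirthAtLeast G (2 * k) → 2 * v < n → HasBadTour k 1 (4 * k) n v
dense-case {k} {n@(suc n′)} {v} 2≤k 3≤n G |G|≡n girth 2v<n
  with graph-dense-trail G (subst (2 * v <_) (sym |G|≡n) 2v<n)
... | W , U , u , W⊆ , cov , bound = M , idTour , kOptimal , Topt , opt , tour-cost-positive M far Topt , ratio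
  where
  open ≤-Reasoning
  0<k : 0 < k
  0<k = ≤-trans (s≤s z≤n) 2≤k
  m = length (trailEdges W)
  -- The trail has at most `n` edges because `G` has `n`; the spare cities stay at its base.
  open WalkSequence (walkSequence n (closedWalk W) (≤-trans (⊆⇒length≤ u W⊆) (≤-reflexive |G|≡n)))
  label : Fin n → Fin v
  label i = at (inject₁ i)
  -- The wrap-around of the tour is consistent because the walk is closed.
  cyclic : ∀ i → at (suc i) ≡ label (sucMod i)
  cyclic i with view i
  ... | ‵fromℕ = trans at-last (trans (sym at-first) (cong label (sym (sucMod-fromℕ n′))))
  ... | ‵inject₁ j = cong label (sym (sucMod-inject₁ j))
  open CappedDistance G k
  open TrailInstance {k = k} 3≤n G girth label step
    (λ i → subst (λ y → Walk (label i) y (step i)) (cyclic i) (stepWalk i)) step≤1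
    (subst Unique (sym steps) u) (subst (All (_∈ edges G)) (sym steps) W⊆)
  m≤cost : m ≤ cost M idTour
  m≤cost = subst (λ es → length es ≤ cost M idTour) steps (length-steps≤cost 0<k)
  used = let e , e∈ , _ = find (base-visited W) in used-step {e} (subst (e ∈_) (sym steps) e∈)
  far : 0 < c M (proj₁ used) (sucMod (proj₁ used))
  far = ≤-trans (proj₂ used) (≤stepCost 0<k (proj₁ used))
  opt-tour = optimalTour M
  Topt = proj₁ opt-tour
  opt = proj₂ opt-tour
  base∈U : base W ∈ U
  base∈U = let e , e∈ , t = find (base-visited W) in cov e∈ t
  cheap = Grouping.cheap-tour M label (λ p q → dist≤cap (label p) (label q))
    (λ {p} {q} eq → trans (cong (dist (label p)) (sym eq)) (dist-refl (label p)))
    (s≤s z≤n) U (λ p → at-covers {_∈ U} base∈U cov (inject₁ p))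
  opt≤ : cost M Topt ≤ k * (2 * length U)
  opt≤ = begin
    cost M Topt               ≤⟨ opt (proj₁ cheap) ⟩
    cost M (proj₁ cheap)      ≤⟨ proj₂ cheap ⟩
    -- The base lies in `U`, so the extra 1 is at most the length of `U`.
    k * suc (length U)        ≤⟨ *-monoʳ-≤ k (+-monoˡ-≤ (length U) (∈-length base∈U)) ⟩
    k * (length U + length U) ≡⟨ cong (λ a → k * (length U + a)) (sym (+-identityʳ (length U))) ⟩
    k * (2 * length U)        ∎
  ratio : 1 * n * cost M Topt ≤ 4 * k * v * cost M idTour
  ratio = begin
    1 * n * cost M Topt            ≡⟨ cong (_* cost M Topt) (*-identityˡ n) ⟩
    n * cost M Topt                ≤⟨ *-monoʳ-≤ n opt≤ ⟩
    n * (k * (2 * length U))       ≡⟨ rearrange₁ n k (length U) ⟩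
    2 * k * (n * length U)         ≤⟨ *-monoʳ-≤ (2 * k) (subst (λ a → a * length U ≤ 2 * v * m) |G|≡n bound) ⟩
    2 * k * (2 * v * m)            ≡⟨ rearrange₂ k v m ⟩
    4 * k * v * m                  ≤⟨ *-monoʳ-≤ (4 * k * v) m≤cost ⟩
    4 * k * v * cost M idTour      ∎
    where
    rearrange₁ : ∀ n k u → n * (k * (2 * u)) ≡ 2 * k * (n * u)
    rearrange₁ = solve-∀
    rearrange₂ : ∀ k v m → 2 * k * (2 * v * m) ≡ 4 * k * v * m
    rearrange₂ = solve-∀

theorem24 : (k : ℕ) → 2 ≤ k →
    Σ ℕ λ a → Σ ℕ λ b → Σ ℕ λ N → 0 < a × 0 < b ×
    ((n : ℕ) → N ≤ n → (v : ℕ) → IsExInv n (2 * k) v →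
    Σ (Metric n) λ M → Σ (Tour n) λ T → KOptimal k M T ×
    Σ (Tour n) λ Topt → OptimalTour M Topt × 0 < cost M Topt ×
    a * n * cost M Topt ≤ b * v * cost M T)
-- The constant is `1 / (4k)`: a factor `2k` from the cheap tour and a factor 2 from the density of
-- the trail. From three cities on, tour edges determine their positions.
theorem24 k 2≤k = 1 , 4 * k , 3 , s≤s z≤n , ≤-trans (≤-trans (s≤s z≤n) 2≤k) (m≤n*m k 4) , instances
  where
  instances : (n : ℕ) → 3 ≤ n → (v : ℕ) → IsExInv n (2 * k) v → HasBadTour k 1 (4 * k) n v
  instances n 3≤n v ((G , |G|≡n , girth) , _) with n ≤? 2 * v
  ... | yes n≤2v = sparse-case 2≤k 3≤n n≤2v
  ... | no n≰2v = dense-case 2≤k 3≤n G |G|≡n girth (≰⇒> n≰2v)
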